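{- Let $w\in\{2,4,6,8,10,12\}$ and let $n\geq 2$ be an integer. Then $M(w,n)$ equals the least nonnegative integer $k$ such that $k\equiv wn \pmod 4$ and such that $k=0$ only if both $w$ and $n$ are multiples of $4$ (that is, $M(w,n)=0$ if $4\mid w$ and $4\mid n$; $M(w,n)=2$ if $wn\equiv 2\pmod 4$; and $M(w,n)=4$ if $wn\equiv 0\pmod 4$ but not both $w,n$ are multiples of $4$), with only the following exceptions: $M(10, n) = 6$ for $n \in\{3, 7, 11, 15, 19, 23\}$.
   Context: The $T$-tetromino is the polyomino formed by four unit squares: three in a row together with a fourth square attached to the middle square of that row. A tiling of an $m\times n$ rectangle (of unit cells) by $T$-tetrominos and monominos is a partition of its cells into copies of the $T$-tetromino (in any rotation or reflection, aligned with the grid) and single cells (monominos). The gap number $M(m,n)$ is the least number of monominos occurring in such a tiling of the $m\times n$ rectangle. -}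

module Defs where

open import Data.Nat using (ℕ; zero; suc; _+_; _*_; _<_; _≤_; _≟_; _%_)
open import Data.Nat.Divisibility using (_∣_; _∣?_)
open import Data.Product using (_×_; _,_; Σ-syntax)
open import Data.List using (List; []; _∷_; concatMap; length; filter)
open import Data.List.Membership.Propositional using (_∈_)
open import Data.List.Membership.DecPropositional using () renaming (_∈?_ to ∈?-gen)
open import Data.List.Relation.Unary.All using (All)
open import Data.List.Relation.Unary.Unique.Propositional using (Unique)
open import Data.Bool using (Bool; true; false; if_then_else_; _∧_)
open import Relation.Nullary.Decidable using (⌊_⌋)
open import Relation.Binary.PropositionalEquality using (_≡_)

-- A cell of the grid: (row , column).
Cell : Set
Cell = ℕ × ℕ

InRect : ℕ → ℕ → Cell → Set
InRect m n (i , j) = (i < m) × (j < n)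

-- The four placements of the T-tetromino (its orbit under rotations
-- and reflections of the grid consists of exactly these 4 shapes),
-- each described inside its bounding box with top-left corner (x , y).
data Orientation : Set where
  up down left right : Orientation

data Piece : Set where
  tee  : (x y : ℕ) → Orientation → Piece
  mono : (x y : ℕ) → Piece

cells : Piece → List Cell
cells (tee x y up)    = (x , y) ∷ (x , suc y) ∷ (x , suc (suc y)) ∷ (suc x , suc y) ∷ []
cells (tee x y down)  = (suc x , y) ∷ (suc x , suc y) ∷ (suc x , suc (suc y)) ∷ (x , suc y) ∷ []
cells (tee x y left)  = (x , y) ∷ (suc x , y) ∷ (suc (suc x) , y) ∷ (suc x , suc y) ∷ []
cells (tee x y right) = (x , suc y) ∷ (suc x , suc y) ∷ (suc (suc x) , suc y) ∷ (suc x , y) ∷ []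
cells (mono x y)      = (x , y) ∷ []

record Tiling (m n : ℕ) : Set where
  field
    pieces  : List Piece
    inside  : All (InRect m n) (concatMap cells pieces)
    disjoint : Unique (concatMap cells pieces)
    covers  : ∀ (c : Cell) → InRect m n c → c ∈ concatMap cells pieces

isMono : Piece → Bool
isMono (tee _ _ _) = false
isMono (mono _ _)  = true

monoCount : List Piece → ℕ
monoCount [] = 0
monoCount (p ∷ ps) = if isMono p then suc (monoCount ps) else monoCount ps

numMonominos : ∀ {m n} → Tiling m n → ℕ
numMonominos t = monoCount (Tiling.pieces t)

IsGapNumber : ℕ → ℕ → ℕ → Set
IsGapNumber m n k =
  (Σ[ t ∈ Tiling m n ] numMonominos t ≡ k) × (∀ (t : Tiling m n) → k ≤ numMonominos t)

expectedGap : ℕ → ℕ → ℕ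
expectedGap w n =
  if ⌊ w ≟ 10 ⌋ ∧ ⌊ ∈?-gen _≟_ n (3 ∷ 7 ∷ 11 ∷ 15 ∷ 19 ∷ 23 ∷ []) ⌋ then 6
  else if ⌊ 4 ∣? w ⌋ ∧ ⌊ 4 ∣? n ⌋ then 0
  else if ⌊ (w * n) % 4 ≟ 2 ⌋ then 2
  else 4

{-# OPTIONS --safe #-}
module Submission where

open import Defs
open import Data.Bool using (Bool; true; false; T; not; _∧_; _∨_; if_then_else_)
open import Data.Bool.Properties using (T-∧; T-∨) renaming (_≟_ to _≟ᵇ_)
open import Data.Empty using (⊥; ⊥-elim)
open import Data.List
  using (List; []; _∷_; _++_; map; foldr; concatMap; length; filterᵇ; replicate; upTo; cartesianProduct)
open import Data.List.Properties using (concatMap-++; length-++; length-upTo; length-map; ≡-dec)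
open import Data.List.Membership.Propositional using (_∈_; find; lose)
open import Data.List.Membership.Propositional.Properties
  using (∈-map⁺; ∈-map⁻; ∈-++⁺ˡ; ∈-++⁺ʳ; ∈-++⁻; ∈-∃++; ∈-concatMap⁺; ∈-concatMap⁻;
         ∈-upTo⁺; ∈-upTo⁻; ∈-cartesianProduct⁺; ∈-cartesianProduct⁻; ∈-filter⁺)
open import Data.List.Membership.Propositional.Properties.WithK using (unique∧set⇒bag)
open import Data.List.Relation.Binary.BagAndSetEquality using (∼bag⇒↭)
open import Data.List.Relation.Binary.Permutation.Propositional using (_↭_; ↭-sym; ↭⇒↭ₛ)
open import Data.List.Relation.Binary.Permutation.Propositional.Properties using (shifts; ∈-resp-↭; ↭-length)
open import Data.List.Relation.Binary.Permutation.Setoid.Properties using (Unique-resp-↭)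
open import Data.List.Relation.Unary.All as All using (All; []; _∷_; all?)
open import Data.List.Relation.Unary.AllPairs using ([]; _∷_)
import Data.List.Relation.Unary.All.Properties as Allₚ
open import Data.List.Relation.Unary.Any using (here; there)
open import Data.List.Relation.Unary.Unique.Propositional using (Unique)
import Data.List.Relation.Unary.Unique.Propositional.Properties as Uniqueₚ
open import Data.Maybe using (Maybe; just; nothing; from-just)
open import Data.Nat
open import Data.List.Membership.DecPropositional _≟_ using (_∈?_)
open import Data.Nat.DivMod
open import Data.Nat.Divisibility
  using (_∣_; divides; _∣?_; %-presˡ-∣; ∣m⇒∣m*n; ∣m∣n⇒∣m+n; ∣m+n∣m⇒∣n; ∣-refl; n∣m*n)
open import Data.Nat.Properties
open import Data.Nat.Tactic.RingSolver using (solve-∀)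
open import Data.Product using (Σ-syntax; ∃; ∃₂; ∃-syntax; _×_; _,_; proj₁; proj₂)
open import Data.Sum using (_⊎_; inj₁; inj₂)
open import Data.Unit using (tt)
open import Function using (_∘_; case_of_; Equivalence; mk⇔)
open import Relation.Binary.PropositionalEquality
open import Relation.Nullary using (¬_; Dec; yes; no; contradiction)
open import Relation.Nullary.Decidable using (T?; ⌊_⌋; from-yes; from-no; toWitness; fromWitness)

-- Scan the cells of the rectangle column by column.  A tiling becomes a path through states, a state
-- recording which of the cells still to be scanned are already covered, and a tiling of n columns is
-- a path of length w n from the all-free state to itself.
-- Lower bounds: counting cells gives the residue of the number of monominoes modulo 4.  The states
-- reachable without monominoes repeat with period 4 in the number of columns, so finitely many of
-- them show that a tiling without monominoes needs 4 ∣ w and 4 ∣ n; the six exceptional rectangles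
-- are excluded by listing all states reachable with at most two monominoes.
-- Upper bounds: explicit tilings containing a segment of four columns without monominoes that returns
-- to the state it started from, and hence may be repeated.

-- Scan states and the overlaying of masks

State : Set
State = List Bool

-- Cells past the end of the list count as free, so a finite list describes all cells still to be
-- scanned, and lists that differ in trailing `false` entries describe the same situation.
at : State → ℕ → Bool
at []      _       = false
at (b ∷ s) zero    = b
at (b ∷ s) (suc k) = at s k

Vacant : State → Set
Vacant = All (_≡ false)

vacant-at : ∀ {s} → (∀ k → at s k ≡ false) → Vacant s
vacant-at {[]}    _ = []
vacant-at {b ∷ s} h = h 0 ∷ vacant-at (h ∘ suc)

at-vacant : ∀ {s} → Vacant s → ∀ k → at s k ≡ false
at-vacant []       k       = refl
at-vacant (e ∷ vs) zero    = e
at-vacant (e ∷ vs) (suc k) = at-vacant vs k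

infix 4 _⊕_↦_

-- Disjoint union of a mask and a state. No constructor puts `true` on `true`, so a derivation is
-- itself the proof that the new piece meets no covered cell; `pad` and `done` serve lists of
-- different lengths.
data _⊕_↦_ : State → State → State → Set where
  done : ∀ {s} → [] ⊕ s ↦ s
  pad  : ∀ {b m t} → m ⊕ [] ↦ t → b ∷ m ⊕ [] ↦ b ∷ t
  keep : ∀ {b m s t} → m ⊕ s ↦ t → false ∷ m ⊕ b ∷ s ↦ b ∷ t
  fill : ∀ {m s t} → m ⊕ s ↦ t → true ∷ m ⊕ false ∷ s ↦ true ∷ t

at-⊕ˡ : ∀ {m s t} → m ⊕ s ↦ t → ∀ k → at m k ≡ true → at t k ≡ true × at s k ≡ false
at-⊕ˡ (pad o)  zero    e = e , refl
at-⊕ˡ (pad o)  (suc k) e = proj₁ (at-⊕ˡ o k e) , refl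
at-⊕ˡ (keep o) (suc k) e = at-⊕ˡ o k e
at-⊕ˡ (fill o) zero    e = refl , refl
at-⊕ˡ (fill o) (suc k) e = at-⊕ˡ o k e

at-⊕ʳ : ∀ {m s t} → m ⊕ s ↦ t → ∀ k → at s k ≡ true → at t k ≡ true
at-⊕ʳ done     k       e = e
at-⊕ʳ (keep o) zero    e = e
at-⊕ʳ (keep o) (suc k) e = at-⊕ʳ o k e
at-⊕ʳ (fill o) (suc k) e = at-⊕ʳ o k e

at-⊕⁻ : ∀ {m s t} → m ⊕ s ↦ t → ∀ k → at t k ≡ true → at m k ≡ true ⊎ at s k ≡ true
at-⊕⁻ done     k       e = inj₂ e
at-⊕⁻ (pad o)  zero    e = inj₁ e
at-⊕⁻ (pad o)  (suc k) e with at-⊕⁻ o k e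
... | inj₁ e′ = inj₁ e′
at-⊕⁻ (keep o) zero    e = inj₂ e
at-⊕⁻ (keep o) (suc k) e = at-⊕⁻ o k e
at-⊕⁻ (fill o) zero    e = inj₁ refl
at-⊕⁻ (fill o) (suc k) e = at-⊕⁻ o k e

overlay? : ∀ m s → Maybe (∃ (m ⊕ s ↦_))
overlay? []          s           = just (s , done)
overlay? (b ∷ m)     []          = Data.Maybe.map (λ (t , o) → b ∷ t , pad o) (overlay? m [])
overlay? (false ∷ m) (b ∷ s)     = Data.Maybe.map (λ (t , o) → b ∷ t , keep o) (overlay? m s)
overlay? (true ∷ m)  (false ∷ s) = Data.Maybe.map (λ (t , o) → true ∷ t , fill o) (overlay? m s)
overlay? (true ∷ m)  (true ∷ s)  = nothing

overlay : ∀ m s → (∀ k → at m k ≡ true → at s k ≡ false) → ∃ (m ⊕ s ↦_)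
overlay []          s           h = s , done
overlay (b ∷ m)     []          h with t , o ← overlay m [] (λ _ _ → refl) = b ∷ t , pad o
overlay (false ∷ m) (b ∷ s)     h with t , o ← overlay m s (h ∘ suc) = b ∷ t , keep o
overlay (true ∷ m)  (false ∷ s) h with t , o ← overlay m s (h ∘ suc) = true ∷ t , fill o
overlay (true ∷ m)  (true ∷ s)  h = case h 0 refl of λ ()

mark : ℕ → State → State
mark zero    []      = true ∷ []
mark zero    (_ ∷ s) = true ∷ s
mark (suc k) []      = false ∷ mark k []
mark (suc k) (b ∷ s) = b ∷ mark k s

at-mark-refl : ∀ k s → at (mark k s) k ≡ true
at-mark-refl zero    []      = refl
at-mark-refl zero    (_ ∷ _) = refl
at-mark-refl (suc k) []      = at-mark-refl k []
at-mark-refl (suc k) (_ ∷ s) = at-mark-refl k s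

at-mark⁺ : ∀ j k s → at s k ≡ true → at (mark j s) k ≡ true
at-mark⁺ zero    zero    (_ ∷ _) e = refl
at-mark⁺ zero    (suc k) (_ ∷ _) e = e
at-mark⁺ (suc j) zero    (_ ∷ _) e = e
at-mark⁺ (suc j) (suc k) (_ ∷ s) e = at-mark⁺ j k s e

at-mark⁻ : ∀ j k s → at (mark j s) k ≡ true → k ≡ j ⊎ at s k ≡ true
at-mark⁻ zero    zero    _       e = inj₁ refl
at-mark⁻ zero    (suc k) []      ()
at-mark⁻ zero    (suc k) (_ ∷ _) e = inj₂ e
at-mark⁻ (suc j) zero    []      ()
at-mark⁻ (suc j) zero    (_ ∷ _) e = inj₂ e
at-mark⁻ (suc j) (suc k) [] e with at-mark⁻ j k [] e
... | inj₁ refl = inj₁ refl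
at-mark⁻ (suc j) (suc k) (_ ∷ s) e with at-mark⁻ j k s e
... | inj₁ refl = inj₁ refl
... | inj₂ e′   = inj₂ e′

marks : List ℕ → State
marks = foldr mark []

∈⇒at-marks : ∀ {k ks} → k ∈ ks → at (marks ks) k ≡ true
∈⇒at-marks {ks = j ∷ ks} (here refl) = at-mark-refl j (marks ks)
∈⇒at-marks {k} {j ∷ ks}  (there i)   = at-mark⁺ j k (marks ks) (∈⇒at-marks i)

at-marks⇒∈ : ∀ {k} ks → at (marks ks) k ≡ true → k ∈ ks
at-marks⇒∈ {k} (j ∷ ks) e with at-mark⁻ j k (marks ks) e
... | inj₁ eq = here eq
... | inj₂ e′ = there (at-marks⇒∈ ks e′)

-- Shapes, anchors and the cells of lists of pieces

data Shape : Set where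
  ∙ △ ▽ ◁ ▷ : Shape

shape : Piece → Shape
shape (tee _ _ up)    = △
shape (tee _ _ down)  = ▽
shape (tee _ _ left)  = ◁
shape (tee _ _ right) = ▷
shape (mono _ _)      = ∙

-- The cell of a piece that comes first in column-by-column order.
anchor : Piece → Cell
anchor (tee x y up)    = x , y
anchor (tee x y down)  = suc x , y
anchor (tee x y left)  = x , y
anchor (tee x y right) = suc x , y
anchor (mono x y)      = x , y

-- Recovers a piece from its shape and its anchor. For `▽` and `▷` in row 0 the truncated `pred`
-- misplaces the anchor; `place` rejects such pieces by comparing positions.
pieceAt : Shape → ℕ → ℕ → Piece
pieceAt ∙ x y = mono x y
pieceAt △ x y = tee x y up
pieceAt ▽ x y = tee (pred x) y down
pieceAt ◁ x y = tee x y left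
pieceAt ▷ x y = tee (pred x) y right

cost : Piece → ℕ
cost P = if isMono P then 1 else 0

monoCount-∷ : ∀ P R → monoCount (P ∷ R) ≡ cost P + monoCount R
monoCount-∷ (tee _ _ _) R = refl
monoCount-∷ (mono _ _)  R = refl

monoCount-++ : ∀ R S → monoCount (R ++ S) ≡ monoCount R + monoCount S
monoCount-++ []               S = refl
monoCount-++ (tee _ _ _ ∷ R)  S = monoCount-++ R S
monoCount-++ (mono _ _ ∷ R)   S = cong suc (monoCount-++ R S)

Achieves : ℕ → ℕ → ℕ → Set
Achieves w n k = Σ[ t ∈ Tiling w n ] numMonominos t ≡ k

cells⋆ : List Piece → List Cell
cells⋆ = concatMap cells

unique-cells : ∀ P → Unique (cells P)
unique-cells (tee x y up)    = ((λ ()) ∷ (λ ()) ∷ (λ ()) ∷ []) ∷ ((λ ()) ∷ (λ ()) ∷ []) ∷ ((λ ()) ∷ []) ∷ [] ∷ []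
unique-cells (tee x y down)  = ((λ ()) ∷ (λ ()) ∷ (λ ()) ∷ []) ∷ ((λ ()) ∷ (λ ()) ∷ []) ∷ ((λ ()) ∷ []) ∷ [] ∷ []
unique-cells (tee x y left)  = ((λ ()) ∷ (λ ()) ∷ (λ ()) ∷ []) ∷ ((λ ()) ∷ (λ ()) ∷ []) ∷ ((λ ()) ∷ []) ∷ [] ∷ []
unique-cells (tee x y right) = ((λ ()) ∷ (λ ()) ∷ (λ ()) ∷ []) ∷ ((λ ()) ∷ (λ ()) ∷ []) ∷ ((λ ()) ∷ []) ∷ [] ∷ []
unique-cells (mono x y)      = [] ∷ []

anchor∈cells : ∀ P → anchor P ∈ cells P
anchor∈cells (tee x y up)    = here refl
anchor∈cells (tee x y down)  = here refl
anchor∈cells (tee x y left)  = here refl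
anchor∈cells (tee x y right) = there (there (there (here refl)))
anchor∈cells (mono x y)      = here refl

unique-++ˡ⇒disjoint : ∀ {A : Set} (xs : List A) {ys x} → Unique (xs ++ ys) → x ∈ xs → x ∈ ys → ⊥
unique-++ˡ⇒disjoint (x ∷ xs) (x∉ ∷ u) (here refl) j = All.lookup x∉ (∈-++⁺ʳ xs j) refl
unique-++ˡ⇒disjoint (x ∷ xs) (x∉ ∷ u) (there i)   j = unique-++ˡ⇒disjoint xs u i j

unique-++ʳ : ∀ {A : Set} (xs : List A) {ys} → Unique (xs ++ ys) → Unique ys
unique-++ʳ []       u       = u
unique-++ʳ (_ ∷ xs) (_ ∷ u) = unique-++ʳ xs u

cells⋆-shift : ∀ R P S → cells⋆ (R ++ P ∷ S) ↭ cells⋆ (P ∷ R ++ S)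
cells⋆-shift R P S
  rewrite concatMap-++ cells R (P ∷ S) | concatMap-++ cells R S
  = shifts (cells⋆ R) (cells P)

-- Counting cells modulo 4

length-cells⋆ : ∀ R → ∃[ t ] length (cells⋆ R) ≡ monoCount R + t * 4
length-cells⋆ [] = 0 , refl
length-cells⋆ (mono _ _ ∷ R) with t , e ← length-cells⋆ R = t , cong suc e
length-cells⋆ (tee x y o ∷ R) with t , e ← length-cells⋆ R = suc t , (begin
  length (cells (tee x y o) ++ cells⋆ R)         ≡⟨ length-++ (cells (tee x y o)) ⟩
  length (cells (tee x y o)) + length (cells⋆ R) ≡⟨ cong₂ _+_ (four o) e ⟩
  4 + (monoCount R + t * 4)                      ≡⟨ lem (monoCount R) (t * 4) ⟩
  monoCount R + suc t * 4                        ∎)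
  where
  open ≡-Reasoning
  four : ∀ o → length (cells (tee x y o)) ≡ 4
  four up    = refl
  four down  = refl
  four left  = refl
  four right = refl
  lem : ∀ a b → 4 + (a + b) ≡ a + (4 + b)
  lem = solve-∀

length-cartesianProduct : ∀ {A B : Set} (xs : List A) (ys : List B) →
  length (cartesianProduct xs ys) ≡ length xs * length ys
length-cartesianProduct []       ys = refl
length-cartesianProduct (x ∷ xs) ys =
  trans (length-++ (map (x ,_) ys)) (cong₂ _+_ (length-map (x ,_) ys) (length-cartesianProduct xs ys))

-- The covered cells and the cells of the rectangle form two repetition-free lists with the same
-- members, hence permutations of each other.
length-tiling : ∀ {w n} (t : Tiling w n) → length (cells⋆ (Tiling.pieces t)) ≡ w * n
length-tiling {w} {n} t = begin
  length (cells⋆ pieces)                          ≡⟨ ↭-length (∼bag⇒↭ (unique∧set⇒bag disjoint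
                                                       (Uniqueₚ.cartesianProduct⁺ (Uniqueₚ.upTo⁺ w) (Uniqueₚ.upTo⁺ n))
                                                       (mk⇔ to from))) ⟩
  length (cartesianProduct (upTo w) (upTo n))     ≡⟨ length-cartesianProduct (upTo w) (upTo n) ⟩
  length (upTo w) * length (upTo n)               ≡⟨ cong₂ _*_ (length-upTo w) (length-upTo n) ⟩
  w * n                                           ∎
  where
  open ≡-Reasoning
  open Tiling t
  to : ∀ {c} → c ∈ cells⋆ pieces → c ∈ cartesianProduct (upTo w) (upTo n)
  to i with x<w , y<n ← All.lookup inside i = ∈-cartesianProduct⁺ (∈-upTo⁺ x<w) (∈-upTo⁺ y<n)
  from : ∀ {c} → c ∈ cartesianProduct (upTo w) (upTo n) → c ∈ cells⋆ pieces
  from i with x∈ , y∈ ← ∈-cartesianProduct⁻ (upTo w) (upTo n) i = covers _ (∈-upTo⁻ x∈ , ∈-upTo⁻ y∈)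

monoCount≡area : ∀ {w n} (t : Tiling w n) → numMonominos t % 4 ≡ (w * n) % 4
monoCount≡area {w} {n} t with q , e ← length-cells⋆ (Tiling.pieces t) = begin
  numMonominos t % 4               ≡⟨ [m+kn]%n≡m%n (numMonominos t) q 4 ⟨
  (numMonominos t + q * 4) % 4     ≡⟨ cong (_% 4) (trans (sym e) (length-tiling t)) ⟩
  (w * n) % 4                      ∎
  where open ≡-Reasoning

-- Sets of states as tries

infixr 6 _∪_

-- Branches on whether the next cell is free (left) or covered (right). The leaf `zeros` holds the
-- vacant lists of every length, so no depth has to be fixed.
data Trie : Set where
  ∅ zeros : Trie
  node    : Trie → Trie → Trie

infix 4 _∈ᵗ_

-- The empty list goes left by `ends`, since it reads as a run of free cells. The operations on
-- tries are only shown to lose no member: an over-approximation is enough to prove that tilings do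
-- not exist.
data _∈ᵗ_ : State → Trie → Set where
  zeros : ∀ {s} → Vacant s → s ∈ᵗ zeros
  ends  : ∀ {l r} → [] ∈ᵗ l → [] ∈ᵗ node l r
  left  : ∀ {s l r} → s ∈ᵗ l → false ∷ s ∈ᵗ node l r
  right : ∀ {s l r} → s ∈ᵗ r → true ∷ s ∈ᵗ node l r

mkNode : Trie → Trie → Trie
mkNode ∅ ∅ = ∅
mkNode l r = node l r

mkNode⁺ : ∀ {s} l r → s ∈ᵗ node l r → s ∈ᵗ mkNode l r
mkNode⁺ ∅          ∅          (ends ())
mkNode⁺ ∅          ∅          (left ())
mkNode⁺ ∅          ∅          (right ())
mkNode⁺ ∅          zeros      i = i
mkNode⁺ ∅          (node _ _) i = i
mkNode⁺ zeros      _          i = i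
mkNode⁺ (node _ _) _          i = i

_∪_ : Trie → Trie → Trie
∅        ∪ u        = u
t        ∪ ∅        = t
zeros    ∪ zeros    = zeros
zeros    ∪ node l r = node (zeros ∪ l) r
node l r ∪ zeros    = node (l ∪ zeros) r
node l r ∪ node m s = node (l ∪ m) (r ∪ s)

∪⁺ˡ : ∀ {s} t u → s ∈ᵗ t → s ∈ᵗ t ∪ u
∪⁺ˡ zeros      ∅          i = i
∪⁺ˡ zeros      zeros      i = i
∪⁺ˡ zeros      (node l r) (zeros [])         = ends (∪⁺ˡ zeros l (zeros []))
∪⁺ˡ zeros      (node l r) (zeros (refl ∷ v)) = left (∪⁺ˡ zeros l (zeros v))
∪⁺ˡ (node _ _) ∅          i = i
∪⁺ˡ (node l r) zeros      (ends i)  = ends (∪⁺ˡ l zeros i)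
∪⁺ˡ (node l r) zeros      (left i)  = left (∪⁺ˡ l zeros i)
∪⁺ˡ (node l r) zeros      (right i) = right i
∪⁺ˡ (node l r) (node m s) (ends i)  = ends (∪⁺ˡ l m i)
∪⁺ˡ (node l r) (node m s) (left i)  = left (∪⁺ˡ l m i)
∪⁺ˡ (node l r) (node m s) (right i) = right (∪⁺ˡ r s i)

∪⁺ʳ : ∀ {s} t u → s ∈ᵗ u → s ∈ᵗ t ∪ u
∪⁺ʳ ∅          u          i = i
∪⁺ʳ zeros      zeros      i = i
∪⁺ʳ zeros      (node l r) (ends i)  = ends (∪⁺ʳ zeros l i)
∪⁺ʳ zeros      (node l r) (left i)  = left (∪⁺ʳ zeros l i)
∪⁺ʳ zeros      (node l r) (right i) = right i
∪⁺ʳ (node l r) zeros      (zeros [])         = ends (∪⁺ʳ l zeros (zeros []))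
∪⁺ʳ (node l r) zeros      (zeros (refl ∷ v)) = left (∪⁺ʳ l zeros (zeros v))
∪⁺ʳ (node l r) (node m s) (ends i)  = ends (∪⁺ʳ l m i)
∪⁺ʳ (node l r) (node m s) (left i)  = left (∪⁺ʳ l m i)
∪⁺ʳ (node l r) (node m s) (right i) = right (∪⁺ʳ r s i)

-- The scan may leave a cell only once it is covered, so a step keeps the branch with `true` in
-- front and drops that entry.
occupied : Trie → Trie
occupied ∅          = ∅
occupied zeros      = ∅
occupied (node _ r) = r

occupied⁺ : ∀ {s} t → true ∷ s ∈ᵗ t → s ∈ᵗ occupied t
occupied⁺ zeros      (zeros (() ∷ _))
occupied⁺ (node _ r) (right i) = i

-- Overlays one mask on all members at once; branches where the mask meets a covered cell are cut
-- off.
stamp : State → Trie → Trie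
stamp []          t          = t
stamp (_ ∷ _)     ∅          = ∅
stamp (false ∷ m) zeros      = mkNode (stamp m zeros) ∅
stamp (true ∷ m)  zeros      = mkNode ∅ (stamp m zeros)
stamp (false ∷ m) (node l r) = mkNode (stamp m l) (stamp m r)
stamp (true ∷ m)  (node l r) = mkNode ∅ (stamp m l)

stamp⁺ : ∀ {m s s′} t → m ⊕ s ↦ s′ → s ∈ᵗ t → s′ ∈ᵗ stamp m t
stamp⁺ t          done              i                  = i
stamp⁺ zeros      (pad {false} o)   (zeros [])         = mkNode⁺ _ ∅ (left (stamp⁺ zeros o (zeros [])))
stamp⁺ zeros      (pad {true} o)    (zeros [])         = mkNode⁺ ∅ _ (right (stamp⁺ zeros o (zeros [])))
stamp⁺ zeros      (keep o)          (zeros (refl ∷ v)) = mkNode⁺ _ ∅ (left (stamp⁺ zeros o (zeros v)))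
stamp⁺ zeros      (fill o)          (zeros (refl ∷ v)) = mkNode⁺ ∅ _ (right (stamp⁺ zeros o (zeros v)))
stamp⁺ (node l r) (pad {false} {m} o) (ends i)         = mkNode⁺ _ (stamp m r) (left (stamp⁺ l o i))
stamp⁺ (node l r) (pad {true} o)    (ends i)           = mkNode⁺ ∅ _ (right (stamp⁺ l o i))
stamp⁺ (node l r) (keep {m = m} o)  (left i)           = mkNode⁺ _ (stamp m r) (left (stamp⁺ l o i))
stamp⁺ (node l r) (keep {m = m} o)  (right i)          = mkNode⁺ (stamp m l) _ (right (stamp⁺ r o i))
stamp⁺ (node l r) (fill o)          (left i)           = mkNode⁺ ∅ _ (right (stamp⁺ l o i))

hasVacant : Trie → Bool
hasVacant ∅          = false
hasVacant zeros      = true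
hasVacant (node l _) = hasVacant l

hasVacant⁺ : ∀ {s} t → s ∈ᵗ t → Vacant s → T (hasVacant t)
hasVacant⁺ zeros      i        v       = tt
hasVacant⁺ (node l r) (ends i) v       = hasVacant⁺ l i v
hasVacant⁺ (node l r) (left i) (_ ∷ v) = hasVacant⁺ l i v
hasVacant⁺ (node l r) (right i) (() ∷ _)

_⊆ᵇ_ : Trie → Trie → Bool
∅        ⊆ᵇ _        = true
zeros    ⊆ᵇ ∅        = false
zeros    ⊆ᵇ zeros    = true
zeros    ⊆ᵇ node l _ = zeros ⊆ᵇ l
node l r ⊆ᵇ ∅        = l ⊆ᵇ ∅ ∧ r ⊆ᵇ ∅
node l r ⊆ᵇ zeros    = l ⊆ᵇ zeros ∧ r ⊆ᵇ ∅
node l r ⊆ᵇ node m s = l ⊆ᵇ m ∧ r ⊆ᵇ s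

T-∧⁻ : ∀ {a b} → T (a ∧ b) → T a × T b
T-∧⁻ = Equivalence.to T-∧

⊆ᵇ⇒⊆ : ∀ {s} t u → T (t ⊆ᵇ u) → s ∈ᵗ t → s ∈ᵗ u
⊆ᵇ⇒⊆ zeros      zeros      h i                  = i
⊆ᵇ⇒⊆ zeros      (node l r) h (zeros [])         = ends (⊆ᵇ⇒⊆ zeros l h (zeros []))
⊆ᵇ⇒⊆ zeros      (node l r) h (zeros (refl ∷ v)) = left (⊆ᵇ⇒⊆ zeros l h (zeros v))
⊆ᵇ⇒⊆ (node l r) ∅          h (ends i)  = case ⊆ᵇ⇒⊆ l ∅ (proj₁ (T-∧⁻ h)) i of λ ()
⊆ᵇ⇒⊆ (node l r) ∅          h (left i)  = case ⊆ᵇ⇒⊆ l ∅ (proj₁ (T-∧⁻ h)) i of λ ()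
⊆ᵇ⇒⊆ (node l r) ∅          h (right i) = case ⊆ᵇ⇒⊆ r ∅ (proj₂ (T-∧⁻ {l ⊆ᵇ ∅} h)) i of λ ()
⊆ᵇ⇒⊆ (node l r) zeros      h (ends i)  = zeros []
⊆ᵇ⇒⊆ (node l r) zeros      h (left i)
  with zeros v ← ⊆ᵇ⇒⊆ l zeros (proj₁ (T-∧⁻ h)) i = zeros (refl ∷ v)
⊆ᵇ⇒⊆ (node l r) zeros      h (right i) = case ⊆ᵇ⇒⊆ r ∅ (proj₂ (T-∧⁻ {l ⊆ᵇ zeros} h)) i of λ ()
⊆ᵇ⇒⊆ (node l r) (node m s) h (ends i)  = ends (⊆ᵇ⇒⊆ l m (proj₁ (T-∧⁻ h)) i)
⊆ᵇ⇒⊆ (node l r) (node m s) h (left i)  = left (⊆ᵇ⇒⊆ l m (proj₁ (T-∧⁻ h)) i)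
⊆ᵇ⇒⊆ (node l r) (node m s) h (right i) = right (⊆ᵇ⇒⊆ r s (proj₂ (T-∧⁻ {l ⊆ᵇ m} h)) i)

-- Reachable states graded by the number of monominoes

infix 4 _∈[_]_

-- Entry a of the list collects the states reached with a monominoes; beyond its end nothing is claimed.
data _∈[_]_ (s : State) : ℕ → List Trie → Set where
  beyond : ∀ {a} → s ∈[ a ] []
  here   : ∀ {t ts} → s ∈ᵗ t → s ∈[ 0 ] t ∷ ts
  there  : ∀ {a t ts} → s ∈[ a ] ts → s ∈[ suc a ] t ∷ ts

-- Past the end of the list nothing is known, so the test has to fail there.
noVacant : ℕ → List Trie → Bool
noVacant _       []       = false
noVacant zero    (t ∷ _)  = not (hasVacant t)
noVacant (suc a) (_ ∷ ts) = noVacant a ts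

noVacant⁻ : ∀ {s} a ts → T (noVacant a ts) → s ∈[ a ] ts → ¬ Vacant s
noVacant⁻ zero    (t ∷ _)  h (here i) v with hasVacant t | hasVacant⁺ t i v
... | true | _ = h
noVacant⁻ (suc a) (_ ∷ ts) h (there i) v = noVacant⁻ a ts h i v

onSingle : (Trie → Bool) → List Trie → Bool
onSingle f (t ∷ []) = f t
onSingle f _        = false

onSingle⁻ : ∀ f {ts s} → T (onSingle f ts) → s ∈[ 0 ] ts → ∃[ t ] s ∈ᵗ t × T (f t)
onSingle⁻ f {t ∷ []} h (here i) = t , i , h

-- Positions, masks and paths in a strip of fixed width

module Strip (v : ℕ) where

  -- The form `suc v` makes the width nonzero, as division by `w` requires, and `v` is the offset
  -- from a cell to the one in the next column and the preceding row.
  w : ℕ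
  w = suc v

  pos : Cell → ℕ
  pos (x , y) = x + y * w

  -- Relative to the anchor, and in the order in which `cells` lists the cells, so that `pos-cells`
  -- is an equation between lists.
  offsets : Shape → List ℕ
  offsets ∙ = 0 ∷ []
  offsets △ = 0 ∷ w ∷ w + w ∷ suc w ∷ []
  offsets ▽ = 0 ∷ w ∷ w + w ∷ v ∷ []
  offsets ◁ = 0 ∷ 1 ∷ 2 ∷ suc w ∷ []
  offsets ▷ = v ∷ w ∷ suc w ∷ 0 ∷ []

  mask : Shape → State
  mask ℓ = marks (offsets ℓ)

  -- Rows have to be bounded explicitly, because positions wrap round to the next column. Column
  -- bounds are not imposed on a path; they follow from its final state being vacant.
  Narrow : List Cell → Set
  Narrow = All (λ c → proj₁ c < w)

  pos-suc : ∀ x y → pos (x , suc y) ≡ w + pos (x , y)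
  pos-suc x y = lem x w (y * w)
    where
    lem : ∀ x w a → x + (w + a) ≡ w + (x + a)
    lem = solve-∀

  pos-suc² : ∀ x y → pos (x , suc (suc y)) ≡ w + w + pos (x , y)
  pos-suc² x y = lem x w (y * w)
    where
    lem : ∀ x w a → x + (w + (w + a)) ≡ w + w + (x + a)
    lem = solve-∀

  pos-pred : ∀ x y → pos (x , suc y) ≡ v + pos (suc x , y)
  pos-pred x y = lem x v (y * w)
    where
    lem : ∀ x v a → x + (suc v + a) ≡ v + (suc x + a)
    lem = solve-∀

  pos-cells : ∀ P → map pos (cells P) ≡ map (_+ pos (anchor P)) (offsets (shape P))
  pos-cells (tee x y up)
    rewrite pos-suc x y | pos-suc² x y = refl
  pos-cells (tee x y down)
    rewrite pos-suc (suc x) y | pos-suc² (suc x) y | pos-pred x y = refl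
  pos-cells (tee x y left)
    rewrite pos-suc x y = refl
  pos-cells (tee x y right)
    rewrite pos-pred x y = refl
  pos-cells (mono x y) = refl

  -- Uniqueness of base-`w` digits: reducing modulo `w` recovers the row, and cancelling it leaves
  -- the column.
  pos-injective : ∀ {c d} → proj₁ c < w → proj₁ d < w → pos c ≡ pos d → c ≡ d
  pos-injective {x , y} {x′ , y′} x< x′< e = cong₂ _,_ x≡x′ y≡y′
    where
    x≡x′ : x ≡ x′
    x≡x′ = begin
      x                  ≡⟨ m<n⇒m%n≡m x< ⟨
      x % w              ≡⟨ [m+kn]%n≡m%n x y w ⟨
      (x + y * w) % w    ≡⟨ cong (_% w) e ⟩
      (x′ + y′ * w) % w  ≡⟨ [m+kn]%n≡m%n x′ y′ w ⟩
      x′ % w             ≡⟨ m<n⇒m%n≡m x′< ⟩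
      x′                 ∎
      where open ≡-Reasoning
    y≡y′ : y ≡ y′
    y≡y′ = *-cancelʳ-≡ y y′ w (+-cancelˡ-≡ x _ _ (trans e (cong (_+ y′ * w) (sym x≡x′))))

  cell⇒mask : ∀ P {c} → c ∈ cells P → ∃[ k ] pos c ≡ k + pos (anchor P) × at (mask (shape P)) k ≡ true
  cell⇒mask P i
    with k , k∈ , e ← ∈-map⁻ _ (subst (_ ∈_) (pos-cells P) (∈-map⁺ pos i))
    = k , e , ∈⇒at-marks k∈

  mask-head : ∀ P → at (mask (shape P)) 0 ≡ true
  mask-head P with k , e , m ← cell⇒mask P (anchor∈cells P)
              with refl ← +-cancelʳ-≡ (pos (anchor P)) 0 k e = m

  mask⇒cell : ∀ P k → at (mask (shape P)) k ≡ true → ∃[ c ] c ∈ cells P × k + pos (anchor P) ≡ pos c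
  mask⇒cell P k m = ∈-map⁻ pos (subst (k + pos (anchor P) ∈_) (sym (pos-cells P))
    (∈-map⁺ (_+ pos (anchor P)) (at-marks⇒∈ (offsets (shape P)) m)))

  mask⇒∈cells : ∀ P {c k} → Narrow (cells P) → proj₁ c < w → pos c ≡ k + pos (anchor P) →
    at (mask (shape P)) k ≡ true → c ∈ cells P
  mask⇒∈cells P nP c< e m with d , d∈ , e′ ← mask⇒cell P _ m
    = subst (_∈ cells P) (pos-injective (All.lookup nP d∈) c< (sym (trans e e′))) d∈

  cellAt : ℕ → Cell
  cellAt p = p % w , p / w

  pos-cellAt : ∀ p → pos (cellAt p) ≡ p
  pos-cellAt p = sym (m≡m%n+[m/n]*n p w)

  pos<⇒y< : ∀ n {x y} → pos (x , y) < n * w → y < n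
  pos<⇒y< n {x} {y} lt = *-cancelʳ-< w y n (≤-<-trans (m≤n+m (y * w) x) lt)

  <⇒pos< : ∀ n {x y} → x < w → y < n → pos (x , y) < n * w
  <⇒pos< n {x} {y} x< y< = <-≤-trans (+-monoˡ-< (y * w) x<) (*-monoˡ-≤ w y<)

  -- A column-by-column scan.  State s at position p records which of the cells at positions
  -- p, p + 1, … are covered by the pieces whose anchor lies before p.
  data Path : ℕ → ℕ → State → ℕ → State → Set where
    stop : ∀ {p s} → Path 0 p s 0 s
    skip : ∀ {l p s k t} → Path l (suc p) s k t → Path (suc l) p (true ∷ s) k t
    put  : ∀ {l p s s′ k t} P → pos (anchor P) ≡ p → Narrow (cells P) →
           mask (shape P) ⊕ s ↦ true ∷ s′ → Path l (suc p) s′ k t → Path (suc l) p s (cost P + k) t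

  Path-resp : ∀ {l l′ p p′ s k k′ t} → l ≡ l′ → p ≡ p′ → k ≡ k′ → Path l p s k t → Path l′ p′ s k′ t
  Path-resp refl refl refl π = π

  infixr 5 _⟫_

  _⟫_ : ∀ {l l′ p s k k′ t u} → Path l p s k t → Path l′ (l + p) t k′ u → Path (l + l′) p s (k + k′) u
  stop ⟫ ρ = ρ
  _⟫_ {suc l} {p = p} (skip π) ρ = skip (π ⟫ Path-resp refl (sym (+-suc l p)) refl ρ)
  _⟫_ {suc l} {p = p} (put {k = k} P e nP o π) ρ =
    Path-resp refl refl (sym (+-assoc (cost P) k _)) (put P e nP o (π ⟫ Path-resp refl (sym (+-suc l p)) refl ρ))

  split : ∀ l {l′ p s k u} → Path (l + l′) p s k u →
    ∃₂ λ k₁ k₂ → ∃[ t ] Path l p s k₁ t × Path l′ (l + p) t k₂ u × k ≡ k₁ + k₂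
  split zero π = _ , _ , _ , stop , π , refl
  split (suc l) {p = p} (skip π) with _ , _ , _ , π₁ , π₂ , refl ← split l π =
    _ , _ , _ , skip π₁ , Path-resp refl (+-suc l p) refl π₂ , refl
  split (suc l) {p = p} (put P e nP o π) with k₁ , k₂ , _ , π₁ , π₂ , refl ← split l π =
    _ , _ , _ , put P e nP o π₁ , Path-resp refl (+-suc l p) refl π₂ , sym (+-assoc (cost P) k₁ k₂)

  raise : Piece → Piece
  raise (tee x y o) = tee x (suc y) o
  raise (mono x y)  = mono x (suc y)

  pos-raise : ∀ P → pos (anchor (raise P)) ≡ w + pos (anchor P)
  pos-raise (tee x y up)    = pos-suc x y
  pos-raise (tee x y down)  = pos-suc (suc x) y
  pos-raise (tee x y left)  = pos-suc x y
  pos-raise (tee x y right) = pos-suc (suc x) y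
  pos-raise (mono x y)      = pos-suc x y

  -- Moving a piece by a column changes neither its rows nor its mask; the case split lets the row
  -- bounds of `P` be reused for `raise P`.
  put-raise : ∀ {l p s s′ k t} P → pos (anchor P) ≡ p → Narrow (cells P) →
    mask (shape P) ⊕ s ↦ true ∷ s′ → Path l (suc (w + p)) s′ k t → Path (suc l) (w + p) s (cost P + k) t
  put-raise P@(tee x y up)    refl (a ∷ b ∷ c ∷ d ∷ []) o π = put (raise P) (pos-raise P) (a ∷ b ∷ c ∷ d ∷ []) o π
  put-raise P@(tee x y down)  refl (a ∷ b ∷ c ∷ d ∷ []) o π = put (raise P) (pos-raise P) (a ∷ b ∷ c ∷ d ∷ []) o π
  put-raise P@(tee x y left)  refl (a ∷ b ∷ c ∷ d ∷ []) o π = put (raise P) (pos-raise P) (a ∷ b ∷ c ∷ d ∷ []) o π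
  put-raise P@(tee x y right) refl (a ∷ b ∷ c ∷ d ∷ []) o π = put (raise P) (pos-raise P) (a ∷ b ∷ c ∷ d ∷ []) o π
  put-raise P@(mono x y)      refl (a ∷ []) o π             = put (raise P) (pos-raise P) (a ∷ []) o π

  translate : ∀ {l p s k t} → Path l p s k t → Path l (w + p) s k t
  translate stop              = stop
  translate (skip {p = p} π)  = skip (Path-resp refl (+-suc w p) refl (translate π))
  translate (put {p = p} P e nP o π) = put-raise P e nP o (Path-resp refl (+-suc w p) refl (translate π))

  translate⋆ : ∀ j {l p s k t} → Path l p s k t → Path l (j * w + p) s k t
  translate⋆ zero    π = π
  translate⋆ (suc j) π = Path-resp refl (sym (+-assoc w (j * w) _)) refl (translate (translate⋆ j π))

  -- Tilings correspond to paths ending in a vacant state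

  module _ (n : ℕ) where

    -- The pieces R cover exactly the cells from position p on that s leaves free.
    record Completes (p : ℕ) (s : State) (R : List Piece) : Set where
      field
        unique   : Unique (cells⋆ R)
        inside   : All (InRect w n) (cells⋆ R)
        sound    : ∀ {c} → c ∈ cells⋆ R → ∃[ k ] pos c ≡ k + p × at s k ≡ false
        complete : ∀ {c k} → InRect w n c → pos c ≡ k + p → at s k ≡ false → c ∈ cells⋆ R
        bounded  : ∀ k → at s k ≡ true → k + p < n * w

    open Completes

    inRect-cellAt : ∀ {p} → p < n * w → InRect w n (cellAt p)
    inRect-cellAt {p} lt = m%n<n p w , pos<⇒y< n (subst (_< n * w) (sym (pos-cellAt p)) lt)

    complete-skip : ∀ {p s R} → Completes p (true ∷ s) R → Completes (suc p) s R
    complete-skip {p} C .unique = C .unique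
    complete-skip {p} C .inside = C .inside
    complete-skip {p} C .sound i with C .sound i
    ... | suc k , e , f = k , trans e (sym (+-suc k p)) , f
    complete-skip {p} C .complete {k = k} ic e f = C .complete ic (trans e (+-suc k p)) f
    complete-skip {p} C .bounded k e = subst (_< n * w) (sym (+-suc k p)) (C .bounded (suc k) e)

    complete-unskip : ∀ {p s R} → p < n * w → Completes (suc p) s R → Completes p (true ∷ s) R
    complete-unskip {p} p< C .unique = C .unique
    complete-unskip {p} p< C .inside = C .inside
    complete-unskip {p} p< C .sound i with k , e , f ← C .sound i = suc k , trans e (+-suc k p) , f
    complete-unskip {p} p< C .complete {k = suc k} ic e f = C .complete ic (trans e (sym (+-suc k p))) f
    complete-unskip {p} p< C .bounded zero    e = p<
    complete-unskip {p} p< C .bounded (suc k) e = subst (_< n * w) (+-suc k p) (C .bounded k e)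

    -- `t` marks the cells of `P` in addition to those of `s`. A cell of `R` stays free, because
    -- `Unique` keeps it out of `P`; `bounded` persists because `P` lies inside the rectangle.
    complete-remove : ∀ {p s t P R} → pos (anchor P) ≡ p → mask (shape P) ⊕ s ↦ t →
      Completes p s (P ∷ R) → Completes p t R
    complete-remove {P = P} refl o C .unique = unique-++ʳ (cells P) (C .unique)
    complete-remove {P = P} refl o C .inside = Allₚ.++⁻ʳ (cells P) (C .inside)
    complete-remove {t = t} {P} {R} refl o C .sound {c} i
      with k , e , f ← C .sound (∈-++⁺ʳ (cells P) i) | at t k in eq
    ... | false = k , e , eq
    ... | true with at-⊕⁻ o k eq
    ...   | inj₂ g = case trans (sym f) g of λ ()
    ...   | inj₁ m = ⊥-elim (unique-++ˡ⇒disjoint (cells P) (C .unique)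
              (mask⇒∈cells P (All.map proj₁ (Allₚ.++⁻ˡ (cells P) (C .inside)))
                 (proj₁ (All.lookup (C .inside) (∈-++⁺ʳ (cells P) i))) e m) i)
    complete-remove {s = s} {P = P} refl o C .complete {c} {k} ic e f with at s k in eq
    ... | true  = case trans (sym f) (at-⊕ʳ o k eq) of λ ()
    ... | false with ∈-++⁻ (cells P) (C .complete ic e eq)
    ...   | inj₂ i = i
    ...   | inj₁ i with k′ , e′ , m ← cell⇒mask P i
                   with refl ← +-cancelʳ-≡ (pos (anchor P)) k k′ (trans (sym e) e′)
                   = case trans (sym f) (proj₁ (at-⊕ˡ o k m)) of λ ()
    complete-remove {P = P} refl o C .bounded k e with at-⊕⁻ o k e
    ... | inj₂ g = C .bounded k g
    ... | inj₁ m with d , d∈ , e′ ← mask⇒cell P k m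
                 with x< , y< ← All.lookup (C .inside) (∈-++⁺ˡ d∈)
                 = subst (_< n * w) (sym e′) (<⇒pos< n x< y<)

    -- Converse of `complete-remove`. `P` is disjoint from `R` because its cells are marked in `t`,
    -- and its column bounds are read off from `bounded` for `t`.
    complete-insert : ∀ {p s t P R} → pos (anchor P) ≡ p → Narrow (cells P) → mask (shape P) ⊕ s ↦ t →
      Completes p t R → Completes p s (P ∷ R)
    complete-insert {P = P} {R} refl nP o C .unique = Uniqueₚ.++⁺ (unique-cells P) (C .unique) disj
      where
      disj : ∀ {c} → c ∈ cells P × c ∈ cells⋆ R → ⊥
      disj (i , j) with k , e , m ← cell⇒mask P i | k′ , e′ , f ← C .sound j
                   with refl ← +-cancelʳ-≡ (pos (anchor P)) k k′ (trans (sym e) e′)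
                   = case trans (sym f) (proj₁ (at-⊕ˡ o k m)) of λ ()
    complete-insert {P = P} refl nP o C .inside = Allₚ.++⁺ (All.tabulate ins) (C .inside)
      where
      ins : ∀ {c} → c ∈ cells P → InRect w n c
      ins i with k , e , m ← cell⇒mask P i =
        All.lookup nP i , pos<⇒y< n (subst (_< n * w) (sym e) (C .bounded k (proj₁ (at-⊕ˡ o k m))))
    complete-insert {s = s} {P = P} refl nP o C .sound i with ∈-++⁻ (cells P) i
    ... | inj₁ j with k , e , m ← cell⇒mask P j = k , e , proj₂ (at-⊕ˡ o k m)
    ... | inj₂ j with k , e , f ← C .sound j | at s k in eq
    ...   | false = k , e , eq
    ...   | true  = case trans (sym f) (at-⊕ʳ o k eq) of λ ()
    complete-insert {t = t} {P = P} refl nP o C .complete {k = k} ic e f with at t k in eq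
    ... | false = ∈-++⁺ʳ (cells P) (C .complete ic e eq)
    ... | true with at-⊕⁻ o k eq
    ...   | inj₁ m = ∈-++⁺ˡ (mask⇒∈cells P nP (proj₁ ic) e m)
    ...   | inj₂ g = case trans (sym f) g of λ ()
    complete-insert refl nP o C .bounded k e = C .bounded k (at-⊕ʳ o k e)

    complete-shift : ∀ {p s} R P S → Completes p s (R ++ P ∷ S) → Completes p s (P ∷ R ++ S)
    complete-shift R P S C = record
      { unique   = Unique-resp-↭ (setoid Cell) (↭⇒↭ₛ σ) (C .unique)
      ; inside   = All.tabulate (λ i → All.lookup (C .inside) (∈-resp-↭ (↭-sym σ) i))
      ; sound    = λ i → C .sound (∈-resp-↭ (↭-sym σ) i)
      ; complete = λ ic e f → ∈-resp-↭ σ (C .complete ic e f)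
      ; bounded  = C .bounded
      }
      where σ = cells⋆-shift R P S

    -- Some piece covers the free cell at `p`. Its anchor is not later than `p`, being its earliest
    -- cell, and not earlier, since every cell covered by `R` has position at least `p`.
    complete-covers : ∀ {p s} R → at s 0 ≡ false → p < n * w → Completes p s R → ∃[ P ] P ∈ R × pos (anchor P) ≡ p
    complete-covers {p} {s} R f p< C
      with P , P∈ , c∈P ← find (∈-concatMap⁻ cells (C .complete {k = 0} (inRect-cellAt p<) (pos-cellAt p) f))
      with k , e , _ ← cell⇒mask P c∈P
      with j , e′ , _ ← C .sound (∈-concatMap⁺ cells (lose P∈ (anchor∈cells P)))
      = P , P∈ , ≤-antisym (≤-trans (m≤n+m _ k) (≤-reflexive (trans (sym e) (pos-cellAt p))))
                           (≤-trans (m≤n+m p j) (≤-reflexive (sym e′)))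

    complete-disjoint : ∀ {p s R} P → pos (anchor P) ≡ p → Completes p s (P ∷ R) →
      ∀ k → at (mask (shape P)) k ≡ true → at s k ≡ false
    complete-disjoint P refl C k m
      with d , d∈ , e ← mask⇒cell P k m
      with k′ , e′ , f ← C .sound (∈-++⁺ˡ d∈)
      with refl ← +-cancelʳ-≡ (pos (anchor P)) k k′ (trans e e′) = f

    -- Induction on the number of cells left. A covered cell is skipped; a free one calls
    -- `complete⇒put`, which brings the piece anchored there to the front of the list and removes
    -- it.
    complete⇒path : ∀ l {p s} R → l + p ≡ n * w → Completes p s R → ∃[ t ] Vacant t × Path l p s (monoCount R) t

    complete⇒put : ∀ l {p s} R → at s 0 ≡ false → suc l + p ≡ n * w → Completes p s R →
      ∃[ t ] Vacant t × Path (suc l) p s (monoCount R) t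
    complete⇒put l {p} {s} R f e C
      with P , P∈R , refl ← complete-covers R f (subst (p <_) e (s≤s (m≤n+m p l))) C
      with R₁ , R₂ , refl ← ∈-∃++ P∈R
      with C′ ← complete-shift R₁ P R₂ C
      with overlay (mask (shape P)) s (complete-disjoint P refl C′)
    -- The mask contains offset 0, so the overlay cannot begin with a free cell.
    ... | []        , o = case proj₁ (at-⊕ˡ o 0 (mask-head P)) of λ ()
    ... | false ∷ t , o = case proj₁ (at-⊕ˡ o 0 (mask-head P)) of λ ()
    ... | true ∷ t  , o
      with u , vu , π ← complete⇒path l (R₁ ++ R₂) (trans (+-suc l p) e) (complete-skip (complete-remove refl o C′))
      = u , vu , Path-resp refl refl (sym (begin
          monoCount (R₁ ++ P ∷ R₂)               ≡⟨ monoCount-++ R₁ (P ∷ R₂) ⟩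
          monoCount R₁ + monoCount (P ∷ R₂)      ≡⟨ cong (monoCount R₁ +_) (monoCount-∷ P R₂) ⟩
          monoCount R₁ + (cost P + monoCount R₂) ≡⟨ lem (monoCount R₁) (cost P) (monoCount R₂) ⟩
          cost P + (monoCount R₁ + monoCount R₂) ≡⟨ cong (cost P +_) (monoCount-++ R₁ R₂) ⟨
          cost P + monoCount (R₁ ++ R₂)          ∎))
          (put P refl (All.map proj₁ (Allₚ.++⁻ˡ (cells P) (C′ .inside))) o π)
      where
      open ≡-Reasoning
      lem : ∀ a b c → a + (b + c) ≡ b + (a + c)
      lem = solve-∀

    complete⇒path zero {p} {s} [] e C = s , vacant-at (λ k → free k) , stop
      where
      free : ∀ k → at s k ≡ false
      free k with at s k in eq
      ... | false = refl
      -- Here `p` is already the end of the rectangle, so `bounded` leaves no covered cell.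
      ... | true  = contradiction (C .bounded k eq) (≤⇒≯ (subst (_≤ k + p) e (m≤n+m p k)))
    complete⇒path zero {p} (P ∷ R) e C
      with k , e′ , _ ← C .sound (∈-++⁺ˡ (anchor∈cells P))
      with x< , y< ← All.lookup (C .inside) (∈-++⁺ˡ {ys = cells⋆ R} (anchor∈cells P))
      = contradiction (<⇒pos< n x< y<) (≤⇒≯ (subst₂ _≤_ e (sym e′) (m≤n+m p k)))
    complete⇒path (suc l) {s = []} R e C = complete⇒put l R refl e C
    complete⇒path (suc l) {s = false ∷ s} R e C = complete⇒put l R refl e C
    complete⇒path (suc l) {p} {s = true ∷ s} R e C
      with t , vt , π ← complete⇒path l R (trans (+-suc l p) e) (complete-skip C) = t , vt , skip π

    -- Pieces are restored from the end of the path backwards. Vacancy of the final state gives the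
    -- first `bounded`, which keeps pieces from sticking out of the last column.
    path⇒complete : ∀ {l p s k t} → Vacant t → l + p ≡ n * w → Path l p s k t →
      ∃[ R ] Completes p s R × monoCount R ≡ k
    path⇒complete {p = p} {s} vt e stop = [] , record
      { unique   = []
      ; inside   = []
      ; sound    = λ ()
      ; complete = λ {_} {k} (x< , y<) e′ _ →
          contradiction (<⇒pos< n x< y<) (≤⇒≯ (subst₂ _≤_ e (sym e′) (m≤n+m p k)))
      ; bounded  = λ k f → case trans (sym f) (at-vacant vt k) of λ ()
      } , refl
    path⇒complete {suc l} {p} vt e (skip π)
      with R , C , m ← path⇒complete vt (trans (+-suc l p) e) π
      = R , complete-unskip (subst (p <_) e (s≤s (m≤n+m p l))) C , m
    path⇒complete {suc l} {p} vt e (put P eP nP o π)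
      with R , C , m ← path⇒complete vt (trans (+-suc l p) e) π
      = P ∷ R , complete-insert eP nP o (complete-unskip (subst (p <_) e (s≤s (m≤n+m p l))) C)
      , trans (monoCount-∷ P R) (cong (cost P +_) m)

    tiling⇒path : (t : Tiling w n) → ∃[ s ] Vacant s × Path (n * w) 0 [] (numMonominos t) s
    tiling⇒path t = complete⇒path (n * w) (t .Tiling.pieces) (+-identityʳ _) record
      { unique   = t .Tiling.disjoint
      ; inside   = t .Tiling.inside
      ; sound    = λ {c} _ → pos c , sym (+-identityʳ _) , refl
      ; complete = λ ic _ _ → t .Tiling.covers _ ic
      ; bounded  = λ _ ()
      }

    path⇒tiling : ∀ {k t} → Vacant t → Path (n * w) 0 [] k t → Σ[ t ∈ Tiling w n ] numMonominos t ≡ k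
    path⇒tiling vt π with R , C , m ← path⇒complete vt (+-identityʳ _) π = record
      { pieces   = R
      ; inside   = C .inside
      ; disjoint = C .unique
      ; covers   = λ c ic → C .complete ic (sym (+-identityʳ _)) refl
      } , m

  -- Sweeping sets of reachable states across columns

  fits : Shape → ℕ → Bool
  fits ∙ x = true
  fits △ x = suc x <ᵇ w
  fits ▽ x = 0 <ᵇ x
  fits ◁ x = suc (suc x) <ᵇ w
  fits ▷ x = (0 <ᵇ x) ∧ (suc x <ᵇ w)

  narrow-fits : ∀ P → Narrow (cells P) → T (fits (shape P) (proj₁ (anchor P)))
  narrow-fits (tee x y up)    (_ ∷ _ ∷ _ ∷ lt ∷ []) = <⇒<ᵇ lt
  narrow-fits (tee x y down)  _                     = tt
  narrow-fits (tee x y left)  (_ ∷ _ ∷ lt ∷ _ ∷ []) = <⇒<ᵇ lt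
  narrow-fits (tee x y right) (_ ∷ _ ∷ lt ∷ _ ∷ []) = <⇒<ᵇ lt
  narrow-fits (mono x y)      _                     = tt

  teeMasks : ℕ → List State
  teeMasks x = map mask (filterᵇ (λ ℓ → fits ℓ x) (△ ∷ ▽ ∷ ◁ ∷ ▷ ∷ []))

  mask∈teeMasks : ∀ x y o → Narrow (cells (tee x y o)) →
    mask (shape (tee x y o)) ∈ teeMasks (pos (anchor (tee x y o)) % w)
  mask∈teeMasks x y o nP = ∈-map⁺ mask (∈-filter⁺ (λ ℓ → T? (fits ℓ _)) (listed o)
    (subst (T ∘ fits (shape P)) (sym column) (narrow-fits P nP)))
    where
    P = tee x y o
    listed : ∀ o → shape (tee x y o) ∈ △ ∷ ▽ ∷ ◁ ∷ ▷ ∷ []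
    listed up    = here refl
    listed down  = there (here refl)
    listed left  = there (there (here refl))
    listed right = there (there (there (here refl)))
    column : pos (anchor P) % w ≡ proj₁ (anchor P)
    column = trans ([m+kn]%n≡m%n (proj₁ (anchor P)) (proj₂ (anchor P)) w)
                   (m<n⇒m%n≡m (All.lookup nP (anchor∈cells P)))

  putOne : List State → Trie → Trie
  putOne ms t = foldr (λ m u → occupied (stamp m t) ∪ u) ∅ ms

  putOne⁺ : ∀ {ms m s s′} t → m ∈ ms → m ⊕ s ↦ true ∷ s′ → s ∈ᵗ t → s′ ∈ᵗ putOne ms t
  putOne⁺ {m ∷ ms} t (here refl) o i = ∪⁺ˡ _ (putOne ms t) (occupied⁺ (stamp m t) (stamp⁺ t o i))
  putOne⁺ {m ∷ ms} t (there j)   o i = ∪⁺ʳ (occupied (stamp m t)) _ (putOne⁺ t j o i)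

  -- The argument prev is the trie with one monomino less.
  advance : List State → Trie → List Trie → List Trie
  advance ms prev []       = []
  advance ms prev (t ∷ ts) = (occupied t ∪ putOne ms t ∪ putOne (mask ∙ ∷ []) prev) ∷ advance ms t ts

  advance-skip : ∀ {ms s a} prev {ts} → true ∷ s ∈[ a ] ts → s ∈[ a ] advance ms prev ts
  advance-skip prev beyond            = beyond
  advance-skip prev (here {t} i)      = here (∪⁺ˡ (occupied t) _ (occupied⁺ t i))
  advance-skip prev (there {t = t} i) = there (advance-skip t i)

  advance-tee : ∀ {ms m s s′ a} prev {ts} → m ∈ ms → m ⊕ s ↦ true ∷ s′ → s ∈[ a ] ts → s′ ∈[ a ] advance ms prev ts
  advance-tee prev j o beyond            = beyond
  advance-tee prev j o (here {t} i)      = here (∪⁺ʳ (occupied t) _ (∪⁺ˡ _ _ (putOne⁺ t j o i)))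
  advance-tee prev j o (there {t = t} i) = there (advance-tee t j o i)

  advance-prev : ∀ {ms s s′} prev ts → mask ∙ ⊕ s ↦ true ∷ s′ → s ∈ᵗ prev → s′ ∈[ 0 ] advance ms prev ts
  advance-prev prev []            o i = beyond
  advance-prev {ms} prev (t ∷ ts) o i =
    here (∪⁺ʳ (occupied t) _ (∪⁺ʳ (putOne ms t) _ (putOne⁺ {mask ∙ ∷ []} prev (here refl) o i)))

  advance-mono : ∀ {ms s s′ a} prev {ts} → mask ∙ ⊕ s ↦ true ∷ s′ → s ∈[ a ] ts → s′ ∈[ suc a ] advance ms prev ts
  advance-mono prev o beyond               = beyond
  advance-mono prev o (here {t} {ts} i)    = there (advance-prev t ts o i)
  advance-mono prev o (there {t = t} i)    = there (advance-mono t o i)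

  -- `∅` is passed as the trie preceding entry 0, as no count is below zero. The list keeps its
  -- length, so larger counts are dropped.
  sweep : ℕ → ℕ → List Trie → List Trie
  sweep zero    p ts = ts
  sweep (suc l) p ts = sweep l (suc p) (advance (teeMasks (p % w)) ∅ ts)

  sweep⁺ : ∀ {l p s k t a ts} → Path l p s k t → s ∈[ a ] ts → t ∈[ k + a ] sweep l p ts
  sweep⁺ stop i = i
  sweep⁺ (skip π) i = sweep⁺ π (advance-skip ∅ i)
  sweep⁺ {a = a} {ts} (put {l} {k = k} {t} (mono x y) refl nP o π) i =
    subst (t ∈[_] sweep (suc l) (x + y * w) ts) (+-suc k a) (sweep⁺ π (advance-mono ∅ o i))
  sweep⁺ (put (tee x y φ) refl nP o π) i = sweep⁺ π (advance-tee ∅ (mask∈teeMasks x y φ nP) o i)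

  -- The admissible masks depend on a position only through its residue modulo `w`, so one function
  -- `column` serves every column.
  sweep-translate : ∀ l j p ts → sweep l (j * w + p) ts ≡ sweep l p ts
  sweep-translate zero    j p ts = refl
  sweep-translate (suc l) j p ts = trans
    (cong₂ (λ q x → sweep l q (advance (teeMasks x) ∅ ts)) (sym (+-suc (j * w) p))
      (trans (cong (_% w) (+-comm (j * w) p)) ([m+kn]%n≡m%n p j w)))
    (sweep-translate l j (suc p) _)

  column : List Trie → List Trie
  column = sweep w 0

  column⁺ : ∀ j {s k t a ts} → Path w (j * w) s k t → s ∈[ a ] ts → t ∈[ k + a ] column ts
  column⁺ j {ts = ts} π i = subst (_ ∈[ _ ]_)
    (trans (cong (λ p → sweep w p ts) (sym (+-identityʳ (j * w)))) (sweep-translate w j 0 ts)) (sweep⁺ π i)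

  columns : ℕ → List Trie → List Trie
  columns zero    ts = ts
  columns (suc n) ts = columns n (column ts)

  columns⁺ : ∀ n j {s k t a ts} → Path (n * w) (j * w) s k t → s ∈[ a ] ts → t ∈[ k + a ] columns n ts
  columns⁺ zero    j stop i = i
  columns⁺ (suc n) j {t = u} {a} {ts} π i with k₁ , k₂ , t , π₁ , π₂ , refl ← split w π =
    subst (u ∈[_] columns (suc n) ts) (trans (sym (+-assoc k₂ k₁ a)) (cong (_+ a) (+-comm k₂ k₁)))
      (columns⁺ n (suc j) π₂ (column⁺ j π₁ i))

  -- With ts the states reached at the end of column n: for each of the l columns from n on,
  -- ok holds or no tiling with exactly k monominoes ends there.
  clear : (ℕ → Bool) → ℕ → ℕ → ℕ → List Trie → Bool
  clear ok k zero    n ts = true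
  clear ok k (suc l) n ts = (ok n ∨ noVacant k ts) ∧ clear ok k l (suc n) (column ts)

  -- Generalised for the induction: `a` monominoes are spent before the path starts, and the path
  -- may lie at any column `j`, independently of the column count `n`.
  clear⁻ : ∀ ok k l n ts → T (clear ok k l n ts) → ∀ i → i < l → ∀ j {s b t a} → s ∈[ a ] ts →
    Path (i * w) (j * w) s b t → Vacant t → b + a ≡ k → T (ok (i + n))
  clear⁻ ok k (suc l) n ts h zero lt j {a = a} s∈ stop vt refl
    with Equivalence.to (T-∨ {ok n}) (proj₁ (T-∧⁻ h))
  ... | inj₁ g = g
  ... | inj₂ g = ⊥-elim (noVacant⁻ a ts g s∈ vt)
  clear⁻ ok k (suc l) n ts h (suc i) (s≤s lt) j {a = a} s∈ π vt e
    with k₁ , k₂ , t , π₁ , π₂ , refl ← split w π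
    = subst (T ∘ ok) (+-suc i n)
        (clear⁻ ok k l (suc n) (column ts) (proj₂ (T-∧⁻ {ok n ∨ noVacant k ts} h)) i lt (suc j) (column⁺ j π₁ s∈) π₂ vt
          (trans (trans (sym (+-assoc k₂ k₁ a)) (cong (_+ a) (+-comm k₂ k₁))) e))

  -- Period four of the sweeps without monominoes

  fourDivides : ℕ → Bool
  fourDivides n = ⌊ 4 ∣? w ⌋ ∧ ⌊ 4 ∣? n ⌋

  -- An invariant for blocks of four columns: `t` is mapped into itself, and inside a block a vacant
  -- state occurs only where `fourDivides` allows it. Columns may be counted from `t`, since
  -- `certificate` takes `t` after eight columns.
  closed : Trie → Bool
  closed t = clear fourDivides 0 4 0 (t ∷ []) ∧ onSingle (_⊆ᵇ t) (columns 4 (t ∷ []))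

  -- The initial state is vacant for every width, so column 0 is exempt.
  unobstructed : ℕ → Bool
  unobstructed n = (n ≡ᵇ 0) ∨ fourDivides n

  -- Without monominoes the sets of states reached at the ends of columns have period 4
  -- from column 8 on, for each of the widths in question.
  certificate : Bool
  certificate = clear unobstructed 0 8 0 (zeros ∷ []) ∧ onSingle closed (columns 8 (zeros ∷ []))

  splitColumns : ∀ m {n j s k u} → Path ((m + n) * w) (j * w) s k u → k ≡ 0 →
    ∃[ t ] Path (m * w) (j * w) s 0 t × Path (n * w) ((m + j) * w) t 0 u
  splitColumns m {n} {j} π e
    with k₁ , k₂ , t , π₁ , π₂ , e′ ← split (m * w) (Path-resp (*-distribʳ-+ w m n) refl refl π)
    = t
    , Path-resp refl refl (m+n≡0⇒m≡0 k₁ (trans (sym e′) e)) π₁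
    , Path-resp refl (sym (*-distribʳ-+ w m j)) (m+n≡0⇒n≡0 k₁ (trans (sym e′) e)) π₂

  fourDivides⁻ : ∀ n → T (fourDivides n) → 4 ∣ w × 4 ∣ n
  fourDivides⁻ n h with d , e ← T-∧⁻ {⌊ 4 ∣? w ⌋} {⌊ 4 ∣? n ⌋} h =
    toWitness {a? = 4 ∣? w} d , toWitness {a? = 4 ∣? n} e

  fourDivides⁺ : ∀ n → 4 ∣ w → 4 ∣ n → T (fourDivides n)
  fourDivides⁺ n d e = Equivalence.from (T-∧ {⌊ 4 ∣? w ⌋} {⌊ 4 ∣? n ⌋})
    (fromWitness {a? = 4 ∣? w} d , fromWitness {a? = 4 ∣? n} e)

  fourDivides-+4 : ∀ n → T (fourDivides n) → T (fourDivides (4 + n))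
  fourDivides-+4 n h with d , e ← fourDivides⁻ n h = fourDivides⁺ (4 + n) d (∣m∣n⇒∣m+n ∣-refl e)

  closed-base : ∀ t → T (closed t) → ∀ n j {s u} → n < 4 → s ∈ᵗ t →
    Path (n * w) (j * w) s 0 u → Vacant u → T (fourDivides n)
  closed-base t h n j n<4 i π vu = subst (T ∘ fourDivides) (+-identityʳ n)
    (clear⁻ fourDivides 0 4 0 (t ∷ []) (proj₁ (T-∧⁻ h)) n n<4 j (here i) π vu refl)

  -- Each block of four columns leads from `t` back into `t`, so induction in steps of four reduces
  -- to fewer than four columns, where `clear` has tested all cases.
  closed⁻ : ∀ t → T (closed t) → ∀ n j {s u} → s ∈ᵗ t →
    Path (n * w) (j * w) s 0 u → Vacant u → T (fourDivides n)
  closed⁻ t h 0 j = closed-base t h 0 j (from-yes (0 <? 4))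
  closed⁻ t h 1 j = closed-base t h 1 j (from-yes (1 <? 4))
  closed⁻ t h 2 j = closed-base t h 2 j (from-yes (2 <? 4))
  closed⁻ t h 3 j = closed-base t h 3 j (from-yes (3 <? 4))
  closed⁻ t h (suc (suc (suc (suc n)))) j i π vu
    with s , π₁ , π₂ ← splitColumns 4 {n} {j} π refl
    with t′ , i′ , h′ ← onSingle⁻ (_⊆ᵇ t) {columns 4 (t ∷ [])}
                          (proj₂ (T-∧⁻ {clear fourDivides 0 4 0 (t ∷ [])} h))
                          (columns⁺ 4 j {ts = t ∷ []} π₁ (here i))
    = fourDivides-+4 n (closed⁻ t h n (4 + j) (⊆ᵇ⇒⊆ t′ t h′ i′) π₂ vu)

  certificate⁻ : T certificate → ∀ n .{{_ : NonZero n}} {s} →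
    Path (n * w) 0 [] 0 s → Vacant s → T (fourDivides n)
  certificate⁻ h n@(suc n′) π vs with n <? 8
  ... | yes n<8 = subst (T ∘ fourDivides) (+-identityʳ n)
        (clear⁻ unobstructed 0 8 0 (zeros ∷ []) (proj₁ (T-∧⁻ h)) n n<8 0 (here (zeros [])) π vs refl)
  ... | no n≮8 with m , refl ← m≤n⇒∃[o]m+o≡n (≮⇒≥ n≮8)
    with s , π₁ , π₂ ← splitColumns 8 {m} {0} π refl
    with t , i , h′ ← onSingle⁻ closed {columns 8 (zeros ∷ [])}
                        (proj₂ (T-∧⁻ {clear unobstructed 0 8 0 (zeros ∷ [])} h))
                        (columns⁺ 8 0 {ts = zeros ∷ []} π₁ (here (zeros [])))
    -- The first eight columns are added back in two steps of four.
    = fourDivides-+4 (4 + m) (fourDivides-+4 m (closed⁻ t h′ m 8 i π₂ vs))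

  zeroMono⇒4∣ : T certificate → ∀ n .{{_ : NonZero n}} (t : Tiling w n) → numMonominos t ≡ 0 → 4 ∣ w × 4 ∣ n
  zeroMono⇒4∣ h n t e with s , vs , π ← tiling⇒path n t
    = fourDivides⁻ n (certificate⁻ h n (Path-resp refl refl e π) vs)

  -- The `k` empty tries make entry `k` part of the list, so that `noVacant` can succeed there. With
  -- `not ∘ b` as the exemption, vacant states with `k` monominoes are ruled out at the columns
  -- satisfying `b`.
  excluded : ∀ b k l → T (clear (not ∘ b) k l 0 (zeros ∷ replicate k ∅)) →
    ∀ n → n < l → T (b n) → (t : Tiling w n) → numMonominos t ≢ k
  excluded b k l h n n<l bn t e with s , vs , π ← tiling⇒path n t
    = T-not⁻ (subst (T ∘ not ∘ b) (+-identityʳ n)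
        (clear⁻ (not ∘ b) k l 0 _ h n n<l 0 (here (zeros [])) π vs (trans (+-identityʳ _) e))) bn
    where
    T-not⁻ : ∀ {b} → T (not b) → T b → ⊥
    T-not⁻ {false} _ ()

  -- Tilings from words of shapes

  record Walk (p : ℕ) (s : State) : Set where
    constructor walked
    field
      {len mons} : ℕ
      {end}      : State
      path       : Path len p s mons end

  Placement : ℕ → State → Set
  Placement p s = ∃₂ λ P s′ → pos (anchor P) ≡ p × Narrow (cells P) × mask (shape P) ⊕ s ↦ true ∷ s′

  place : Shape → ∀ p s → Maybe (Placement p s)
  place ℓ p s with pieceAt ℓ (p % w) (p / w)
  ... | P with pos (anchor P) ≟ p | all? (λ c → proj₁ c <? w) (cells P) | overlay? (mask (shape P)) s
  ... | yes e | yes nP | just (true ∷ s′ , o) = just (P , s′ , e , nP , o)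
  ... | _     | _      | _                    = nothing

  -- A word lists the shapes of the pieces in the order of their anchors.
  walk : List Shape → ∀ p s → Maybe (Walk p s)
  walk ℓs       p (true ∷ s) with walk ℓs (suc p) s
  ... | just (walked π) = just (walked (skip π))
  ... | nothing         = nothing
  walk []       p s = just (walked stop)
  walk (ℓ ∷ ℓs) p s with place ℓ p s
  ... | nothing = nothing
  ... | just (P , s′ , e , nP , o) with walk ℓs (suc p) s′
  ...   | just (walked π) = just (walked (put P e nP o π))
  ...   | nothing         = nothing

  -- The segment need not begin at the top of a column: shifting by whole columns preserves rows and
  -- masks.
  repeat : ∀ {p s} → Path (4 * w) p s 0 s → ∀ q → Path (q * (4 * w)) p s 0 s
  repeat ρ zero    = stop
  repeat ρ (suc q) = ρ ⟫ translate⋆ 4 (repeat ρ q)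

  -- All conditions on a concrete word are decidable, so evaluation to `just` certifies the tiling.
  single : ∀ n k → List Shape → Maybe (Achieves w n k)
  single n k us with walk us 0 []
  ... | nothing = nothing
  ... | just (walked {a} {b} {s} π) with a ≟ n * w | b ≟ k | ≡-dec _≟ᵇ_ s []
  ...   | yes refl | yes refl | yes refl = just (path⇒tiling n [] π)
  ...   | _        | _        | _        = nothing

  -- The word vs fills four columns without monominoes and leads back to the same state,
  -- so it may be repeated arbitrarily often.
  family : ∀ n k (us vs xs : List Shape) → Maybe (∀ q → Achieves w (n + q * 4) k)
  family n k us vs xs with walk us 0 []
  ... | nothing = nothing
  ... | just (walked {a} {k₁} {s} π) with walk vs (a + 0) s | walk xs (a + 0) s
  ...   | nothing | _ = nothing
  ...   | just _ | nothing = nothing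
  ...   | just (walked {c} {k′} {s′} ρ) | just (walked {b} {k₂} {u} σ)
        with c ≟ 4 * w | k′ ≟ 0 | ≡-dec _≟ᵇ_ s′ s | ≡-dec _≟ᵇ_ u [] | a + b ≟ n * w | k₁ + k₂ ≟ k
  ...     | yes refl | yes refl | yes refl | yes refl | yes e | yes refl = just λ q →
            path⇒tiling (n + q * 4) []
              (Path-resp (total q) refl refl
                (π ⟫ repeat ρ q ⟫ Path-resp refl (cong (_+ (a + 0)) (*-assoc q 4 w)) refl (translate⋆ (q * 4) σ)))
    where
    lem : ∀ a b c → a + (b + c) ≡ a + c + b
    lem = solve-∀
    total : ∀ q → a + (q * (4 * w) + b) ≡ (n + q * 4) * w
    total q = begin
      a + (q * (4 * w) + b)  ≡⟨ lem a (q * (4 * w)) b ⟩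
      a + b + q * (4 * w)    ≡⟨ cong₂ _+_ e (sym (*-assoc q 4 w)) ⟩
      n * w + q * 4 * w      ≡⟨ *-distribʳ-+ w n (q * 4) ⟨
      (n + q * 4) * w        ∎
      where open ≡-Reasoning
  ...     | _ | _ | _ | _ | _ | _ = nothing

-- Arithmetic of the gap formula

regularGap : ℕ → ℕ → ℕ
regularGap w n =
  if ⌊ 4 ∣? w ⌋ ∧ ⌊ 4 ∣? n ⌋ then 0
  else if ⌊ (w * n) % 4 ≟ 2 ⌋ then 2
  else 4

exceptions : List ℕ
exceptions = 3 ∷ 7 ∷ 11 ∷ 15 ∷ 19 ∷ 23 ∷ []

isExceptional : ℕ → Bool
isExceptional n = ⌊ n ∈? exceptions ⌋

exceptional%4 : ∀ {n} → n ∈ exceptions → n % 4 ≡ 3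
exceptional%4 = All.lookup (toWitness {a? = all? (λ n → n % 4 ≟ 3) exceptions} tt)

exceptional<24 : ∀ {n} → n ∈ exceptions → n < 24
exceptional<24 = All.lookup (toWitness {a? = all? (_<? 24) exceptions} tt)

-- Both tests see `n` only modulo 4, so a family of tilings in one residue class has a constant
-- target.
regularGap-+4 : ∀ w n q → regularGap w (n + q * 4) ≡ regularGap w n
regularGap-+4 w n q = cong₂ (λ b r → if ⌊ 4 ∣? w ⌋ ∧ b then 0 else if ⌊ r ≟ 2 ⌋ then 2 else 4)
  (isYes-⇔ (4 ∣? (n + q * 4)) (4 ∣? n)
    (λ d → ∣m+n∣m⇒∣n (subst (4 ∣_) (+-comm n (q * 4)) d) (n∣m*n q)) (λ d → ∣m∣n⇒∣m+n d (n∣m*n q)))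
  (trans (cong (_% 4) (lem w n q)) ([m+kn]%n≡m%n (w * n) (w * q) 4))
  where
  lem : ∀ w n q → w * (n + q * 4) ≡ w * n + w * q * 4
  lem = solve-∀
  isYes-⇔ : ∀ {P Q : Set} (p? : Dec P) (q? : Dec Q) → (P → Q) → (Q → P) → ⌊ p? ⌋ ≡ ⌊ q? ⌋
  isYes-⇔ (yes _) (yes _) _ _ = refl
  isYes-⇔ (no _)  (no _)  _ _ = refl
  isYes-⇔ (yes p) (no ¬q) f _ = contradiction (f p) ¬q
  isYes-⇔ (no ¬p) (yes q) _ g = contradiction (g q) ¬p

-- `w * n` is even, so `k` is even; if nonzero it is at least 2, and the value 2 forces the residue
-- 2.
regularGap≤ : ∀ {w n k} → 2 ∣ w → k % 4 ≡ (w * n) % 4 → (k ≡ 0 → 4 ∣ w × 4 ∣ n) → regularGap w n ≤ k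
regularGap≤ {w} {n} {k} 2∣w e z = go (4 ∣? w) (4 ∣? n) k e z
  where
  even : ∀ {r} → r ≡ (w * n) % 4 → 2 ∣ r
  even refl = %-presˡ-∣ (∣m⇒∣m*n n 2∣w) (divides 2 refl)
  rest : ∀ k → k % 4 ≡ (w * n) % 4 → k ≢ 0 → (if ⌊ (w * n) % 4 ≟ 2 ⌋ then 2 else 4) ≤ k
  rest k e k≢0 with (w * n) % 4 ≟ 2
  rest 0 e k≢0 | _ = contradiction refl k≢0
  rest 1 e k≢0 | _ = contradiction (even e) (from-no (2 ∣? 1))
  rest (suc (suc k)) e k≢0 | yes _ = s≤s (s≤s z≤n)
  rest 2 e k≢0 | no ¬2 = contradiction (sym e) ¬2
  rest 3 e k≢0 | no ¬2 = contradiction (even e) (from-no (2 ∣? 3))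
  rest (suc (suc (suc (suc k)))) e k≢0 | no _ = s≤s (s≤s (s≤s (s≤s z≤n)))
  go : (w? : Dec (4 ∣ w)) (n? : Dec (4 ∣ n)) → ∀ k → k % 4 ≡ (w * n) % 4 → (k ≡ 0 → 4 ∣ w × 4 ∣ n) →
    (if ⌊ w? ⌋ ∧ ⌊ n? ⌋ then 0 else if ⌊ (w * n) % 4 ≟ 2 ⌋ then 2 else 4) ≤ k
  go (yes _) (yes _) k e z = z≤n
  go (yes _) (no ¬n) k e z = rest k e (¬n ∘ proj₂ ∘ z)
  go (no ¬w) _       k e z = rest k e (¬w ∘ proj₁ ∘ z)

six≤ : ∀ k → k % 4 ≡ 2 → k ≢ 2 → 6 ≤ k
six≤ 2 _ k≢2 = contradiction refl k≢2
six≤ (suc (suc (suc (suc (suc (suc k)))))) _ _ = s≤s (s≤s (s≤s (s≤s (s≤s (s≤s z≤n)))))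

-- The value 2 stands apart because at widths 2, 6 and 10 the family for its residue class starts
-- only at 6.
byResidue : (P : ℕ → Set) → P 2 → (∀ q → P (6 + q * 4)) → (∀ q → P (3 + q * 4)) → (∀ q → P (4 + q * 4)) →
  (∀ q → P (5 + q * 4)) → ∀ n → 2 ≤ n → P n
byResidue P p₂ p₆ p₃ p₄ p₅ (suc (suc n)) (s≤s (s≤s _))
  -- `n` is now the argument less 2, so residue 0 stands for the class of 2.
  with n % 4 | n / 4 | m≡m%n+[m/n]*n n 4 | m%n<n n 4
... | 0 | zero  | refl | _ = p₂
... | 0 | suc q | refl | _ = p₆ q
... | 1 | q     | refl | _ = p₃ q
... | 2 | q     | refl | _ = p₄ q
... | 3 | q     | refl | _ = p₅ q
... | suc (suc (suc (suc _))) | _ | _ | s≤s (s≤s (s≤s (s≤s ())))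

regular : ∀ w n → (∀ q → Achieves w (n + q * 4) (regularGap w n)) →
  ∀ q → Achieves w (n + q * 4) (regularGap w (n + q * 4))
regular w n f q = subst (Achieves w (n + q * 4)) (sym (regularGap-+4 w n q)) (f q)

-- Explicit tilings for each width and residue class

tilings-2-6 : ∀ q → Achieves 2 (6 + q * 4) 4
tilings-2-6 = from-just (Strip.family 1 6 4
      (∙ ∷ ▽ ∷ [])
      (△ ∷ ▽ ∷ [])
      (∙ ∷ ∙ ∷ ▽ ∷ ∙ ∷ []))

tilings-2-3 : ∀ q → Achieves 2 (3 + q * 4) 2
tilings-2-3 = from-just (Strip.family 1 3 2
      (∙ ∷ ▽ ∷ [])
      (△ ∷ ▽ ∷ [])
      (∙ ∷ []))

tilings-2-4 : ∀ q → Achieves 2 (4 + q * 4) 4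
tilings-2-4 = from-just (Strip.family 1 4 4
      (∙ ∷ ▽ ∷ [])
      (△ ∷ ▽ ∷ [])
      (∙ ∷ ∙ ∷ ∙ ∷ []))

tilings-2-5 : ∀ q → Achieves 2 (5 + q * 4) 2
tilings-2-5 = from-just (Strip.family 1 5 2
      (∙ ∷ ▽ ∷ [])
      (△ ∷ ▽ ∷ [])
      (△ ∷ ∙ ∷ []))

tilings-2-2 : Achieves 2 2 4
tilings-2-2 = from-just (Strip.single 1 2 4
      (∙ ∷ ∙ ∷ ∙ ∷ ∙ ∷ []))

-- At widths divisible by four the opening word is empty: the loop alone tiles a block of four whole
-- columns.
tilings-4-2 : ∀ q → Achieves 4 (2 + q * 4) 4
tilings-4-2 = from-just (Strip.family 3 2 4
      []
      (◁ ∷ ▽ ∷ △ ∷ ▷ ∷ [])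
      (∙ ∷ ∙ ∷ ▷ ∷ ∙ ∷ ∙ ∷ []))

tilings-4-3 : ∀ q → Achieves 4 (3 + q * 4) 4
tilings-4-3 = from-just (Strip.family 3 3 4
      []
      (◁ ∷ ▽ ∷ △ ∷ ▷ ∷ [])
      (∙ ∷ ∙ ∷ ∙ ∷ ▽ ∷ ∙ ∷ ▷ ∷ []))

tilings-4-4 : ∀ q → Achieves 4 (4 + q * 4) 0
tilings-4-4 = from-just (Strip.family 3 4 0
      []
      (◁ ∷ ▽ ∷ △ ∷ ▷ ∷ [])
      (◁ ∷ ▽ ∷ △ ∷ ▷ ∷ []))

tilings-4-5 : ∀ q → Achieves 4 (5 + q * 4) 4
tilings-4-5 = from-just (Strip.family 3 5 4
      []
      (◁ ∷ ▽ ∷ △ ∷ ▷ ∷ [])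
      (∙ ∷ ∙ ∷ ∙ ∷ ∙ ∷ ◁ ∷ ▽ ∷ △ ∷ ▷ ∷ []))

tilings-6-6 : ∀ q → Achieves 6 (6 + q * 4) 4
tilings-6-6 = from-just (Strip.family 5 6 4
      (∙ ∷ ▷ ∷ ◁ ∷ ▽ ∷ [])
      (◁ ∷ ▽ ∷ △ ∷ △ ∷ ▷ ∷ ▽ ∷ [])
      (∙ ∷ ◁ ∷ ▷ ∷ △ ∷ ∙ ∷ ▷ ∷ ◁ ∷ ∙ ∷ []))

tilings-6-3 : ∀ q → Achieves 6 (3 + q * 4) 2
tilings-6-3 = from-just (Strip.family 5 3 2
      (△ ∷ ∙ ∷ ◁ ∷ ▽ ∷ [])
      (▷ ∷ ▷ ∷ ◁ ∷ △ ∷ ◁ ∷ ▽ ∷ [])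
      (▷ ∷ ∙ ∷ []))

tilings-6-4 : ∀ q → Achieves 6 (4 + q * 4) 4
tilings-6-4 = from-just (Strip.family 5 4 4
      (∙ ∷ ∙ ∷ ∙ ∷ ◁ ∷ [])
      (◁ ∷ ▽ ∷ ▽ ∷ △ ∷ ▷ ∷ △ ∷ [])
      (△ ∷ ◁ ∷ ▽ ∷ ▷ ∷ ∙ ∷ []))

tilings-6-5 : ∀ q → Achieves 6 (5 + q * 4) 2
tilings-6-5 = from-just (Strip.family 5 5 2
      (◁ ∷ ◁ ∷ △ ∷ ∙ ∷ ▽ ∷ ▽ ∷ [])
      (▽ ∷ △ ∷ △ ∷ △ ∷ ▽ ∷ ▽ ∷ [])
      (▷ ∷ ∙ ∷ ▷ ∷ []))

tilings-6-2 : Achieves 6 2 4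
tilings-6-2 = from-just (Strip.single 5 2 4
      (∙ ∷ ∙ ∷ ▷ ∷ ◁ ∷ ∙ ∷ ∙ ∷ []))

tilings-8-2 : ∀ q → Achieves 8 (2 + q * 4) 4
tilings-8-2 = from-just (Strip.family 7 2 4
      []
      (◁ ∷ ▷ ∷ ◁ ∷ ▽ ∷ △ ∷ ▷ ∷ ◁ ∷ ▷ ∷ [])
      (∙ ∷ ∙ ∷ ▷ ∷ ◁ ∷ ▷ ∷ ∙ ∷ ∙ ∷ []))

tilings-8-3 : ∀ q → Achieves 8 (3 + q * 4) 4
tilings-8-3 = from-just (Strip.family 7 3 4
      []
      (◁ ∷ ▷ ∷ ◁ ∷ ▽ ∷ △ ∷ ▷ ∷ ◁ ∷ ▷ ∷ [])
      (∙ ∷ ◁ ∷ ◁ ∷ ▽ ∷ ∙ ∷ ▷ ∷ ∙ ∷ ▷ ∷ ∙ ∷ []))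

tilings-8-4 : ∀ q → Achieves 8 (4 + q * 4) 0
tilings-8-4 = from-just (Strip.family 7 4 0
      []
      (◁ ∷ ▷ ∷ ◁ ∷ ▽ ∷ △ ∷ ▷ ∷ ◁ ∷ ▷ ∷ [])
      (◁ ∷ ▷ ∷ ◁ ∷ ▽ ∷ △ ∷ ▷ ∷ ◁ ∷ ▷ ∷ []))

tilings-8-5 : ∀ q → Achieves 8 (5 + q * 4) 4
tilings-8-5 = from-just (Strip.family 7 5 4
      []
      (◁ ∷ ▷ ∷ ◁ ∷ ▽ ∷ △ ∷ ▷ ∷ ◁ ∷ ▷ ∷ [])
      (∙ ∷ ∙ ∷ ◁ ∷ ◁ ∷ ◁ ∷ ▷ ∷ ∙ ∷ ▽ ∷ △ ∷ ∙ ∷ ▷ ∷ ◁ ∷ ▷ ∷ []))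

tilings-10-6 : ∀ q → Achieves 10 (6 + q * 4) 4
tilings-10-6 = from-just (Strip.family 9 6 4
      (∙ ∷ ▷ ∷ ◁ ∷ ▷ ∷ ◁ ∷ ▽ ∷ [])
      (◁ ∷ ▷ ∷ ◁ ∷ ▽ ∷ △ ∷ △ ∷ ▷ ∷ ◁ ∷ ▷ ∷ ▽ ∷ [])
      (∙ ∷ ◁ ∷ ▷ ∷ ◁ ∷ ▷ ∷ △ ∷ ∙ ∷ ▷ ∷ ◁ ∷ ▷ ∷ ◁ ∷ ∙ ∷ []))

-- 27 is the first length congruent to 3 modulo 4 beyond the exceptions, hence the long closing
-- word.
tilings-10-27 : ∀ q → Achieves 10 (27 + q * 4) 2
tilings-10-27 = from-just (Strip.family 9 27 2
      (◁ ∷ ▽ ∷ ∙ ∷ ▷ ∷ ◁ ∷ ▽ ∷ [])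
      (△ ∷ ▷ ∷ ◁ ∷ ▽ ∷ △ ∷ △ ∷ ◁ ∷ ▽ ∷ ▷ ∷ ▽ ∷ [])
      (△ ∷ ▷ ∷ ◁ ∷ ▽ ∷ △ ∷ ▷ ∷ ◁ ∷ △ ∷ ▽ ∷ △ ∷ △ ∷ ◁ ∷ ▽ ∷ ▽ ∷ △ ∷ ▷ ∷ △ ∷ ▷ ∷ ▽ ∷ ◁ ∷ ▽ ∷ △ ∷ △ ∷ ◁ ∷ ▷ ∷
       ▽ ∷ ▷ ∷ △ ∷ ◁ ∷ ▽ ∷ ▷ ∷ ◁ ∷ ▽ ∷ △ ∷ △ ∷ △ ∷ ◁ ∷ ▽ ∷ ▽ ∷ ▽ ∷ ▷ ∷ △ ∷ ▷ ∷ △ ∷ ◁ ∷ ▽ ∷ △ ∷ △ ∷ ◁ ∷ ▽ ∷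
       ▽ ∷ ▷ ∷ ▽ ∷ ▷ ∷ ◁ ∷ ▽ ∷ △ ∷ ◁ ∷ ▽ ∷ △ ∷ ▷ ∷ ▷ ∷ ∙ ∷ []))

tilings-10-4 : ∀ q → Achieves 10 (4 + q * 4) 4
tilings-10-4 = from-just (Strip.family 9 4 4
      (∙ ∷ ∙ ∷ ∙ ∷ ◁ ∷ ◁ ∷ ▽ ∷ [])
      (◁ ∷ ▽ ∷ ▽ ∷ △ ∷ △ ∷ ▷ ∷ ▷ ∷ △ ∷ ◁ ∷ ▽ ∷ [])
      (△ ∷ ◁ ∷ ▽ ∷ △ ∷ ▷ ∷ ▷ ∷ ∙ ∷ []))

tilings-10-5 : ∀ q → Achieves 10 (5 + q * 4) 2
tilings-10-5 = from-just (Strip.family 9 5 2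
      (◁ ∷ ◁ ∷ ▷ ∷ ◁ ∷ △ ∷ ∙ ∷ ▷ ∷ ▽ ∷ [])
      (◁ ∷ ▽ ∷ △ ∷ ◁ ∷ ▽ ∷ △ ∷ ▷ ∷ △ ∷ ▷ ∷ ▽ ∷ [])
      (◁ ∷ ▷ ∷ ◁ ∷ ▷ ∷ ∙ ∷ ▷ ∷ []))

tilings-10-2 : Achieves 10 2 4
tilings-10-2 = from-just (Strip.single 9 2 4
      (∙ ∷ ∙ ∷ ▷ ∷ ◁ ∷ ▷ ∷ ◁ ∷ ∙ ∷ ∙ ∷ []))

-- Serves the exceptional lengths 3 to 23, that is `q` from 0 to 5.
tilings-10-3 : ∀ q → Achieves 10 (3 + q * 4) 6
tilings-10-3 = from-just (Strip.family 9 3 6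
      (∙ ∷ ∙ ∷ ∙ ∷ ◁ ∷ ◁ ∷ ▽ ∷ [])
      (◁ ∷ ▽ ∷ ▽ ∷ △ ∷ △ ∷ ▷ ∷ ▷ ∷ △ ∷ ◁ ∷ ▽ ∷ [])
      (◁ ∷ ▷ ∷ ∙ ∷ ▷ ∷ ∙ ∷ ∙ ∷ []))

tilings-12-2 : ∀ q → Achieves 12 (2 + q * 4) 4
tilings-12-2 = from-just (Strip.family 11 2 4
      []
      (◁ ∷ ▷ ∷ ◁ ∷ ▷ ∷ ◁ ∷ ▽ ∷ △ ∷ ▷ ∷ ◁ ∷ ▷ ∷ ◁ ∷ ▷ ∷ [])
      (∙ ∷ ∙ ∷ ▷ ∷ ◁ ∷ ▷ ∷ ◁ ∷ ▷ ∷ ∙ ∷ ∙ ∷ []))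

tilings-12-3 : ∀ q → Achieves 12 (3 + q * 4) 4
tilings-12-3 = from-just (Strip.family 11 3 4
      []
      (◁ ∷ ▷ ∷ ◁ ∷ ▷ ∷ ◁ ∷ ▽ ∷ △ ∷ ▷ ∷ ◁ ∷ ▷ ∷ ◁ ∷ ▷ ∷ [])
      (△ ∷ ∙ ∷ ◁ ∷ ◁ ∷ ◁ ∷ ▽ ∷ ▷ ∷ ∙ ∷ ▷ ∷ ∙ ∷ ▷ ∷ ∙ ∷ []))

tilings-12-4 : ∀ q → Achieves 12 (4 + q * 4) 0
tilings-12-4 = from-just (Strip.family 11 4 0
      []
      (◁ ∷ ▷ ∷ ◁ ∷ ▷ ∷ ◁ ∷ ▽ ∷ △ ∷ ▷ ∷ ◁ ∷ ▷ ∷ ◁ ∷ ▷ ∷ [])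
      (◁ ∷ ▷ ∷ ◁ ∷ ▷ ∷ ◁ ∷ ▽ ∷ △ ∷ ▷ ∷ ◁ ∷ ▷ ∷ ◁ ∷ ▷ ∷ []))

tilings-12-5 : ∀ q → Achieves 12 (5 + q * 4) 4
tilings-12-5 = from-just (Strip.family 11 5 4
      []
      (◁ ∷ ▷ ∷ ◁ ∷ ▷ ∷ ◁ ∷ ▽ ∷ △ ∷ ▷ ∷ ◁ ∷ ▷ ∷ ◁ ∷ ▷ ∷ [])
      (∙ ∷ ∙ ∷ ▽ ∷ △ ∷ ∙ ∷ ◁ ∷ ▷ ∷ ◁ ∷ △ ∷ ▷ ∷ ▽ ∷ ▽ ∷ △ ∷ ∙ ∷ ▷ ∷ ◁ ∷ ▷ ∷ ▷ ∷ []))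


-- Upper bounds

regularGap-10 : ∀ n → ¬ n ∈ exceptions → expectedGap 10 n ≡ regularGap 10 n
regularGap-10 n n∉ = go (n ∈? exceptions)
  where
  -- At the other widths `expectedGap` unfolds to `regularGap`; at width 10 the list test is stuck
  -- on the variable `n` and has to be decided.
  go : (n? : Dec (n ∈ exceptions)) → (if ⌊ n? ⌋ then 6 else regularGap 10 n) ≡ regularGap 10 n
  go (yes n∈) = contradiction n∈ n∉
  go (no _)   = refl

regular-10 : ∀ n → n % 4 ≢ 3 → (∀ q → Achieves 10 (n + q * 4) (regularGap 10 n)) →
  ∀ q → Achieves 10 (n + q * 4) (expectedGap 10 (n + q * 4))
regular-10 n n%4≢3 f q = subst (Achieves 10 (n + q * 4))
  (sym (regularGap-10 (n + q * 4) (λ i → n%4≢3 (trans (sym ([m+kn]%n≡m%n n q 4)) (exceptional%4 i))))) (regular 10 n f q)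

tilings-10 : ∀ q → Achieves 10 (3 + q * 4) (expectedGap 10 (3 + q * 4))
tilings-10 0 = tilings-10-3 0
tilings-10 1 = tilings-10-3 1
tilings-10 2 = tilings-10-3 2
tilings-10 3 = tilings-10-3 3
tilings-10 4 = tilings-10-3 4
tilings-10 5 = tilings-10-3 5
-- Six more blocks of four make the length at least 27, past the last exception.
tilings-10 (suc (suc (suc (suc (suc (suc q)))))) = subst (Achieves 10 (27 + q * 4))
  (sym (regularGap-10 (27 + q * 4) (λ i → contradiction (exceptional<24 i) (m+n≮m 24 (3 + q * 4)))))
  (regular 10 27 tilings-10-27 q)

upper : ∀ {w n} → w ∈ 2 ∷ 4 ∷ 6 ∷ 8 ∷ 10 ∷ 12 ∷ [] → 2 ≤ n → Achieves w n (expectedGap w n)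
upper {n = n} (here refl) = byResidue (λ n → Achieves 2 n (expectedGap 2 n)) tilings-2-2
  (regular 2 6 tilings-2-6) (regular 2 3 tilings-2-3) (regular 2 4 tilings-2-4) (regular 2 5 tilings-2-5) n
upper {n = n} (there (here refl)) = byResidue (λ n → Achieves 4 n (expectedGap 4 n)) (tilings-4-2 0)
  -- The family starting at 2 gives the lengths from 6 on by shifting `q` by one.
  (regular 4 2 tilings-4-2 ∘ suc) (regular 4 3 tilings-4-3) (regular 4 4 tilings-4-4) (regular 4 5 tilings-4-5) n
upper {n = n} (there (there (here refl))) = byResidue (λ n → Achieves 6 n (expectedGap 6 n)) tilings-6-2
  (regular 6 6 tilings-6-6) (regular 6 3 tilings-6-3) (regular 6 4 tilings-6-4) (regular 6 5 tilings-6-5) n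
upper {n = n} (there (there (there (here refl)))) = byResidue (λ n → Achieves 8 n (expectedGap 8 n)) (tilings-8-2 0)
  (regular 8 2 tilings-8-2 ∘ suc) (regular 8 3 tilings-8-3) (regular 8 4 tilings-8-4) (regular 8 5 tilings-8-5) n
upper {n = n} (there (there (there (there (here refl))))) = byResidue (λ n → Achieves 10 n (expectedGap 10 n)) tilings-10-2
  (regular-10 6 (λ ()) tilings-10-6) tilings-10 (regular-10 4 (λ ()) tilings-10-4) (regular-10 5 (λ ()) tilings-10-5) n
upper {n = n} (there (there (there (there (there (here refl)))))) = byResidue (λ n → Achieves 12 n (expectedGap 12 n)) (tilings-12-2 0)
  (regular 12 2 tilings-12-2 ∘ suc) (regular 12 3 tilings-12-3) (regular 12 4 tilings-12-4) (regular 12 5 tilings-12-5) n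

-- Lower bounds

regular-lower : ∀ v → 2 ∣ suc v → T (Strip.certificate v) → ∀ n .{{_ : NonZero n}} (t : Tiling (suc v) n) →
  regularGap (suc v) n ≤ numMonominos t
regular-lower v 2∣w h n t = regularGap≤ 2∣w (monoCount≡area t) (Strip.zeroMono⇒4∣ v h n t)

lower-10 : ∀ n .{{_ : NonZero n}} (t : Tiling 10 n) → expectedGap 10 n ≤ numMonominos t
lower-10 n t = go (n ∈? exceptions)
  where
  go : (n? : Dec (n ∈ exceptions)) → (if ⌊ n? ⌋ then 6 else regularGap 10 n) ≤ numMonominos t
  -- For `n` congruent to 3 the area `10 * n` is 2 modulo 4. The count 2 is excluded by sweeping the
  -- columns below 24, which include all exceptions, so 6 is the next candidate.
  go (yes i) = six≤ (numMonominos t)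
    (trans (monoCount≡area t) (trans (%-distribˡ-* 10 n 4) (cong (λ r → (2 * r) % 4) (exceptional%4 i))))
    (Strip.excluded 9 isExceptional 2 24 tt n (exceptional<24 i) (fromWitness {a? = n ∈? exceptions} i) t)
  go (no _)  = regular-lower 9 (divides 5 refl) tt n t

lower : ∀ {w n} → w ∈ 2 ∷ 4 ∷ 6 ∷ 8 ∷ 10 ∷ 12 ∷ [] → 2 ≤ n → (t : Tiling w n) → expectedGap w n ≤ numMonominos t
-- The certificate of each concrete width evaluates to `true`, so `tt` proves it.
lower {n = n} (here refl) 2≤n = regular-lower 1 (divides 1 refl) tt n {{>-nonZero (<⇒≤ 2≤n)}}
lower {n = n} (there (here refl)) 2≤n = regular-lower 3 (divides 2 refl) tt n {{>-nonZero (<⇒≤ 2≤n)}}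
lower {n = n} (there (there (here refl))) 2≤n = regular-lower 5 (divides 3 refl) tt n {{>-nonZero (<⇒≤ 2≤n)}}
lower {n = n} (there (there (there (here refl)))) 2≤n = regular-lower 7 (divides 4 refl) tt n {{>-nonZero (<⇒≤ 2≤n)}}
lower {n = n} (there (there (there (there (here refl))))) 2≤n = lower-10 n {{>-nonZero (<⇒≤ 2≤n)}}
lower {n = n} (there (there (there (there (there (here refl)))))) 2≤n = regular-lower 11 (divides 6 refl) tt n {{>-nonZero (<⇒≤ 2≤n)}}

theorem4 : ∀ (w n : ℕ) → w ∈ (2 ∷ 4 ∷ 6 ∷ 8 ∷ 10 ∷ 12 ∷ []) → 2 ≤ n →
    IsGapNumber w n (expectedGap w n)
theorem4 w n w∈ 2≤n = upper w∈ 2≤n , lower w∈ 2≤n
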